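{- Let $T$ be a complete first-order theory with monster model $\bar M$, and let $\mathfrak p$ be a global type that is generically stable and strongly regular. Then: (1) $\mathfrak p$ is minimal in the global Rudin–Keisler order $\leq_{RK}$, i.e. for every non-algebraic global type $\mathfrak q$, if $\mathfrak q\leq_{RK}\mathfrak p$ then $\mathfrak p\leq_{RK}\mathfrak q$. (2) For every invariant global type $\mathfrak q$: $\mathfrak p$ and $\mathfrak q$ are non-orthogonal if and only if $\mathfrak p\leq_{RK}\mathfrak q$.
   Context: $T$ is a complete first-order theory with monster model $\bar M$; "small" means of cardinality less than the saturation of $\bar M$. A global type is a complete type over $\bar M$ (in finitely many variables); $\mathfrak p\upharpoonright A$ is the restriction of $\mathfrak p$ to $A$. Realizations of global types live in a larger monster model. For small $A$, $\mathfrak p(x)$ is $A$-invariant if for all $\bar b_1\equiv\bar b_2\,(A)$ and all formulas $\phi(x;\bar y)$ over $A$: $\phi(x,\bar b_1)\in\mathfrak p$ iff $\phi(x,\bar b_2)\in\mathfrak p$; it is invariant if it is $A$-invariant for some small $A$. Morley sequence: $(a_i\mid i<\alpha)$ is a Morley sequence in $\mathfrak p$ over $A$ if $a_i\models\mathfrak p\upharpoonright Aa_{<i}$ for all $i<\alpha$. Generic stability: a non-algebraic global type $\mathfrak p$ is generically stable if for some small $A$ it is $A$-invariant and, for every infinite $\alpha$ and every Morley sequence $(a_i\mid i<\alpha)$ in $\mathfrak p$ over $A$, for every formula $\phi(x)$ with parameters from $\bar M$ the set $\{i\mid\ \models\phi(a_i)\}$ is finite or co-finite. Strong regularity (for types in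 a single variable, possibly of a sort of $\bar M^{eq}$): $(\mathfrak p(x),\phi(x))$ is an $A$-invariant pair if $\mathfrak p$ is $A$-invariant and $\phi(x)\in\mathfrak p\upharpoonright A$. $(\mathfrak p,\phi)$ is strongly regular if for some small $A$ it is an $A$-invariant pair and for all small $B\supseteq A$ and all $a$ satisfying $\phi(x)$: either $a\models\mathfrak p\upharpoonright B$ or $\mathfrak p\upharpoonright B\vdash\mathfrak p\upharpoonright Ba$. $\mathfrak p$ is strongly regular if $(\mathfrak p,\phi)$ is strongly regular for some $\phi\in\mathfrak p$. Orthogonality: global types $\mathfrak p,\mathfrak q$ are orthogonal if $\mathfrak p(x)\cup\mathfrak q(y)$ (disjoint variables) determines a complete type over $\bar M$; otherwise non-orthogonal. Semi-isolation: $\bar b\in\mathrm{Sem}_A(\bar a)$ iff some formula in $\mathrm{tp}(\bar b/A\bar a)$ implies $\mathrm{tp}(\bar b/A)$. Rudin–Keisler order: $\mathfrak p\leq_{RK}\mathfrak q$ iff there are $\bar a\models\mathfrak p$ and $\bar b\models\mathfrak q$ with $\bar a\in\mathrm{Sem}_{\bar M}(\bar b)$. This is a quasi-order. -}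

module Defs where

open import Level using (Level; _⊔_) renaming (suc to lsuc)
open import Data.Empty.Polymorphic using (⊥)
open import Data.List.Base using (List; []; _∷_; _++_; map)
open import Data.List.Membership.Propositional using () renaming (_∈_ to _∈ˡ_)
open import Data.List.Relation.Unary.All as All using (All; []; _∷_)
open import Data.List.Relation.Unary.All.Properties using (++⁺; map⁺)
open import Data.Nat.Base using (ℕ)
open import Data.Product.Base using (Σ; ∃; ∃-syntax; _×_; _,_)
open import Data.Sum.Base using (_⊎_)
open import Function.Bundles using (_⇔_; _↔_; _↣_; Inverse)
open import Induction.WellFounded using (WellFounded)
open import Relation.Binary.Core using () renaming (Rel to BinRel)
open import Relation.Binary.PropositionalEquality.Core using (_≡_)
open import Relation.Binary.Structures using (IsStrictTotalOrder)
open import Relation.Nullary.Negation.Core using (¬_)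
open import Relation.Unary using (Pred; _∈_; _⊆_; _∪_; _≐_; ∁; U; ｛_｝)

private
  variable
    a b ℓ : Level

------------------------------------------------------------------------
-- Cardinality

infix 4 _≺_

-- |A| < |B|.
_≺_ : Set a → Set b → Set (a ⊔ b)
A ≺ B = (A ↣ B) × ¬ (B ↣ A)

Finite : {A : Set a} → Pred A b → Set (a ⊔ b)
Finite P = ∃[ xs ] (∀ {x} → x ∈ P → x ∈ˡ xs)

Cofinite : {A : Set a} → Pred A b → Set (a ⊔ b)
Cofinite P = Finite (∁ P)

Infinite : Set a → Set a
Infinite A = ¬ Finite {A = A} U

------------------------------------------------------------------------
-- First-order logic

-- Languages are many-sorted, so that T may be of the form T₀^eq, with monster
-- model M₀^eq; a single variable then ranges over any sort of M₀^eq.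
record Language ℓ : Set (lsuc ℓ) where
  field
    Sort  : Set ℓ
    Fun   : Set ℓ
    dom   : Fun → List Sort
    cod   : Fun → Sort
    Rel   : Set ℓ
    arity : Rel → List Sort

  Symbol : Set ℓ
  Symbol = Sort ⊎ Fun ⊎ Rel

  Context : Set ℓ
  Context = List Sort

open Language using (Context)

module _ (L : Language ℓ) where
  open Language L hiding (Context)

  data Term (Γ : Context L) : Sort → Set ℓ where
    var : ∀ {s} → s ∈ˡ Γ → Term Γ s
    app : (f : Fun) → All (Term Γ) (dom f) → Term Γ (cod f)

  -- The logic is classical, so ⊥, ⇒ and ∀ suffice.
  data Formula (Γ : Context L) : Set ℓ where
    ⊥ᶠ    : Formula Γ
    _≐ᶠ_  : ∀ {s} → Term Γ s → Term Γ s → Formula Γ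
    relᶠ  : (R : Rel) → All (Term Γ) (arity R) → Formula Γ
    _⇒ᶠ_  : Formula Γ → Formula Γ → Formula Γ
    ∀ᶠ    : ∀ s → Formula (s ∷ Γ) → Formula Γ

  Sentence : Set ℓ
  Sentence = Formula []

  Theory : Set (lsuc ℓ)
  Theory = Pred Sentence ℓ

  record Structure : Set (lsuc ℓ) where
    field
      Carrier  : Sort → Set ℓ
      nonempty : ∀ s → Carrier s
      fun      : (f : Fun) → All Carrier (dom f) → Carrier (cod f)
      rel      : (R : Rel) → Pred (All Carrier (arity R)) ℓ

open Structure using (Carrier)

¬ᶠ_ : {L : Language ℓ} {Γ : Context L} → Formula L Γ → Formula L Γ
¬ᶠ φ = φ ⇒ᶠ ⊥ᶠ

module _ {L : Language ℓ} where
  open Language L using (Sort)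

  Env : Structure L → Context L → Set ℓ
  Env M Γ = All (Carrier M) Γ

  module _ (M : Structure L) {Γ : Context L} (e : Env M Γ) where
    mutual
      eval : ∀ {s} → Term L Γ s → Carrier M s
      eval (var x)    = All.lookup e x
      eval (app f ts) = Structure.fun M f (evals ts)

      evals : ∀ {ss} → All (Term L Γ) ss → Env M ss
      evals []       = []
      evals (t ∷ ts) = eval t ∷ evals ts

  infix 4 _⊨_[_]

  _⊨_[_] : (M : Structure L) {Γ : Context L} → Formula L Γ → Env M Γ → Set ℓ
  M ⊨ ⊥ᶠ        [ e ] = ⊥
  M ⊨ t ≐ᶠ u    [ e ] = eval M e t ≡ eval M e u
  M ⊨ relᶠ R ts [ e ] = Structure.rel M R (evals M e ts)
  M ⊨ φ ⇒ᶠ ψ    [ e ] = M ⊨ φ [ e ] → M ⊨ ψ [ e ]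
  M ⊨ ∀ᶠ s φ    [ e ] = (m : Carrier M s) → M ⊨ φ [ m ∷ e ]

  infix 4 _⊨ᵀ_

  _⊨ᵀ_ : Structure L → Theory L → Set ℓ
  M ⊨ᵀ T = ∀ {σ} → σ ∈ T → M ⊨ σ [ [] ]

  -- By Löwenheim–Skolem, models in Set ℓ suffice for a language in Set ℓ.
  Entails : Theory L → Sentence L → Set (lsuc ℓ)
  Entails T σ = (M : Structure L) → M ⊨ᵀ T → M ⊨ σ [ [] ]

  Complete : Theory L → Set (lsuc ℓ)
  Complete T = (∃[ M ] M ⊨ᵀ T) × (∀ σ → Entails T σ ⊎ Entails T (¬ᶠ σ))

  record Automorphism (M : Structure L) : Set ℓ where
    field
      bijection : ∀ s → Carrier M s ↔ Carrier M s

    σ : ∀ {s} → Carrier M s → Carrier M s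
    σ {s} = Inverse.to (bijection s)

    field
      fun-homo : ∀ f xs → σ (Structure.fun M f xs) ≡ Structure.fun M f (All.map σ xs)
      rel-homo : ∀ R xs → Structure.rel M R xs ⇔ Structure.rel M R (All.map σ xs)

  record ElementaryEmbedding (M N : Structure L) : Set ℓ where
    field
      ι          : ∀ {s} → Carrier M s → Carrier N s
      elementary : ∀ {Γ} (φ : Formula L Γ) e → M ⊨ φ [ e ] ⇔ N ⊨ φ [ All.map ι e ]

------------------------------------------------------------------------
-- Formulas with parameters, and sets of them

  Element : Structure L → Set ℓ
  Element M = Σ Sort (Carrier M)

  ParameterSet : Structure L → Set (lsuc ℓ)
  ParameterSet M = Pred (Element M) ℓ

  Range : ∀ M {Γ} → Env M Γ → ParameterSet M
  Range M {Γ} e (s , m) = ∃[ x ] All.lookup {xs = Γ} e {s} x ≡ m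

  -- A formula φ(x̄, d̄) with x̄ : Γ and parameters d̄ from M.
  record PFormula (M : Structure L) (Γ : Context L) : Set ℓ where
    constructor _⟨_⟩
    field
      {Δ}        : Context L
      formula    : Formula L (Γ ++ Δ)
      parameters : Env M Δ

  open PFormula

  ¬ᵖ_ : ∀ {M Γ} → PFormula M Γ → PFormula M Γ
  ¬ᵖ (φ ⟨ d ⟩) = (¬ᶠ φ) ⟨ d ⟩

  FormulaSet : Structure L → Context L → Set (lsuc ℓ)
  FormulaSet M Γ = Pred (PFormula M Γ) ℓ

  module _ {M : Structure L} where

    infix 4 _⊩_ _⊩*_ _⊢_

    _⊩_ : ∀ {Γ} → Env M Γ → PFormula M Γ → Set ℓ
    e ⊩ (φ ⟨ d ⟩) = M ⊨ φ [ ++⁺ e d ]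

    _⊩*_ : ∀ {Γ} → Env M Γ → FormulaSet M Γ → Set ℓ
    e ⊩* Φ = ∀ {φ} → φ ∈ Φ → e ⊩ φ

    -- Consequence modulo the elementary diagram of M, which is finitary by
    -- compactness.  Realizations in M of all of Φ would not do when Φ is not
    -- over a small set.
    _⊢_ : ∀ {Γ} → FormulaSet M Γ → FormulaSet M Γ → Set ℓ
    Φ ⊢ Ψ = ∀ {ψ} → ψ ∈ Ψ →
      ∃[ φs ] All Φ φs × (∀ e → All (e ⊩_) φs → e ⊩ ψ)

    Over : ∀ {Γ} → ParameterSet M → FormulaSet M Γ
    Over A φ = Range M (parameters φ) ⊆ A

    FinitelySatisfiable : ∀ {Γ} → FormulaSet M Γ → Set ℓ
    FinitelySatisfiable Φ = ∀ φs → All Φ φs → ∃[ e ] All (e ⊩_) φs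

  tp : ∀ M {Γ} → Env M Γ → ParameterSet M → FormulaSet M Γ
  tp M e A φ = Over A φ × e ⊩ φ

  -- f ∈ Sem M A e: the tuple f is semi-isolated by e over A.
  Sem : ∀ M {Γ Δ} → ParameterSet M → Env M Γ → Pred (Env M Δ) ℓ
  Sem M A e f = ∃[ φ ] φ ∈ tp M f (A ∪ Range M e) × ｛ φ ｝ ⊢ tp M f A

------------------------------------------------------------------------
-- Monster models

  -- A is small with respect to the cardinal |κ|.
  SmallFor : ∀ M → Set ℓ → ParameterSet M → Set (lsuc ℓ)
  SmallFor M κ A = Σ (Set ℓ) λ I → I ≺ κ ×
    Σ (I → Element M) λ enum → ∀ {m} → m ∈ A → ∃[ i ] enum i ≡ m

  -- |κ|-saturated.
  Saturated : Structure L → Set ℓ → Set (lsuc ℓ)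
  Saturated M κ = ∀ {A} → SmallFor M κ A →
    ∀ {Γ} (Φ : FormulaSet M Γ) → Φ ⊆ Over A → FinitelySatisfiable Φ →
    ∃[ e ] e ⊩* Φ

  -- Strongly |κ|-homogeneous: any elementary map between families indexed by
  -- a small I extends to an automorphism.
  StronglyHomogeneous : Structure L → Set ℓ → Set (lsuc ℓ)
  StronglyHomogeneous M κ = ∀ {I : Set ℓ} → I ≺ κ →
    (s : I → Sort) (f g : ∀ i → Carrier M (s i)) →
    (∀ is (φ : Formula L (map s is)) →
       M ⊨ φ [ map⁺ (All.universal f is) ] ⇔ M ⊨ φ [ map⁺ (All.universal g is) ]) →
    Σ (Automorphism M) λ α → ∀ i → Automorphism.σ α (f i) ≡ g i

record MonsterModel {L : Language ℓ} (T : Theory L) : Set (lsuc ℓ) where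
  field
    structure   : Structure L
    models      : structure ⊨ᵀ T
    κ           : Set ℓ
    uncountable : ℕ ≺ κ
    |L|<κ       : Language.Symbol L ≺ κ
    saturated   : Saturated structure κ
    homogeneous : StronglyHomogeneous structure κ

  Small : ParameterSet structure → Set (lsuc ℓ)
  Small = SmallFor structure κ

-- A larger monster model, in which all of M̄ is small; realizations of types
-- over M̄ are taken there.
record LargerMonster {L : Language ℓ} {T : Theory L} (𝕄 : MonsterModel T)
    : Set (lsuc ℓ) where
  open MonsterModel 𝕄 using () renaming (structure to M)
  field
    monster   : MonsterModel T
  open MonsterModel monster public using () renaming (structure to N)
  field
    embedding : ElementaryEmbedding M N
    |M|<κ     : Element M ≺ MonsterModel.κ monster
  open ElementaryEmbedding embedding public using (ι)

  base : ParameterSet N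
  base (s , n) = ∃[ m ] ι {s} m ≡ n

  ι-formula : ∀ {Γ} → PFormula M Γ → PFormula N Γ
  ι-formula (φ ⟨ d ⟩) = φ ⟨ All.map ι d ⟩

------------------------------------------------------------------------
-- Global types

module _ {L : Language ℓ} {T : Theory L} where

  record GlobalType (𝕄 : MonsterModel T) (Γ : Context L) : Set (lsuc ℓ) where
    open MonsterModel 𝕄 using () renaming (structure to M)
    field
      ⟦_⟧        : FormulaSet M Γ
      consistent : FinitelySatisfiable ⟦_⟧
      complete   : ∀ φ → φ ∈ ⟦_⟧ ⊎ (¬ᵖ φ) ∈ ⟦_⟧

  open GlobalType using (⟦_⟧)

  module _ {𝕄 : MonsterModel T} where
    open MonsterModel 𝕄 using (Small) renaming (structure to M)

    infix 6 _↾_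

    _↾_ : ∀ {Γ} → GlobalType 𝕄 Γ → ParameterSet M → FormulaSet M Γ
    (p ↾ A) φ = φ ∈ ⟦ p ⟧ × Over A φ

    NonAlgebraic : ∀ {Γ} → GlobalType 𝕄 Γ → Set ℓ
    NonAlgebraic p = ∀ {φ} → φ ∈ ⟦ p ⟧ → ¬ Finite (_⊩ φ)

    -- The formula φ(x̄; ȳ) over A is φ(x̄, ȳ, d̄) with d̄ from A.
    InvariantOver : ParameterSet M → ∀ {Γ} → GlobalType 𝕄 Γ → Set ℓ
    InvariantOver A {Γ} p =
      ∀ {Δ Θ} (φ : Formula L (Γ ++ (Δ ++ Θ))) (d : Env M Θ) → Range M d ⊆ A →
      (b₁ b₂ : Env M Δ) → tp M b₁ A ≐ tp M b₂ A →
      (φ ⟨ ++⁺ b₁ d ⟩) ∈ ⟦ p ⟧ ⇔ (φ ⟨ ++⁺ b₂ d ⟩) ∈ ⟦ p ⟧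

    Invariant : ∀ {Γ} → GlobalType 𝕄 Γ → Set (lsuc ℓ)
    Invariant p = ∃[ A ] Small A × InvariantOver A p

    Earlier : ∀ {Γ} {I : Set ℓ} → BinRel I ℓ → (I → Env M Γ) → I → ParameterSet M
    Earlier _<_ a i m = ∃[ j ] j < i × m ∈ Range M (a j)

    MorleySequence : ∀ {Γ} {I : Set ℓ} → BinRel I ℓ → GlobalType 𝕄 Γ →
      ParameterSet M → (I → Env M Γ) → Set ℓ
    MorleySequence _<_ p A a = ∀ i → a i ⊩* p ↾ (A ∪ Earlier _<_ a i)

    -- Infinite ordinals are represented by well-ordered infinite types.
    GenericallyStable : ∀ {Γ} → GlobalType 𝕄 Γ → Set (lsuc ℓ)
    GenericallyStable {Γ} p = NonAlgebraic p ×
      ∃[ A ] Small A × InvariantOver A p ×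
        (∀ {I : Set ℓ} {_<_ : BinRel I ℓ} →
         IsStrictTotalOrder _≡_ _<_ → WellFounded _<_ → Infinite I →
         (a : I → Env M Γ) → MorleySequence _<_ p A a →
         (φ : PFormula M Γ) →
         Finite (λ i → a i ⊩ φ) ⊎ Cofinite (λ i → a i ⊩ φ))

    StronglyRegularPair : ∀ {s} → GlobalType 𝕄 (s ∷ []) → PFormula M (s ∷ []) → Set (lsuc ℓ)
    StronglyRegularPair p φ =
      ∃[ A ] Small A × InvariantOver A p × φ ∈ p ↾ A ×
        (∀ {B} → Small B → A ⊆ B → ∀ a → (a ∷ []) ⊩ φ →
         ((a ∷ []) ⊩* p ↾ B) ⊎ (p ↾ B ⊢ p ↾ (B ∪ Range M (a ∷ []))))

    StronglyRegular : ∀ {s} → GlobalType 𝕄 (s ∷ []) → Set (lsuc ℓ)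
    StronglyRegular p = ∃[ φ ] φ ∈ ⟦ p ⟧ × StronglyRegularPair p φ

    -- p(x̄) ∪ q(ȳ) ⊢ θ(x̄, ȳ).
    JointlyEntails : ∀ {Γ Δ} → GlobalType 𝕄 Γ → GlobalType 𝕄 Δ →
      PFormula M (Γ ++ Δ) → Set ℓ
    JointlyEntails p q θ =
      ∃[ φs ] ∃[ ψs ] All ⟦ p ⟧ φs × All ⟦ q ⟧ ψs ×
        (∀ a b → All (a ⊩_) φs → All (b ⊩_) ψs → ++⁺ a b ⊩ θ)

    Orthogonal : ∀ {Γ Δ} → GlobalType 𝕄 Γ → GlobalType 𝕄 Δ → Set ℓ
    Orthogonal p q = ∀ θ → JointlyEntails p q θ ⊎ JointlyEntails p q (¬ᵖ θ)

    NonOrthogonal : ∀ {Γ Δ} → GlobalType 𝕄 Γ → GlobalType 𝕄 Δ → Set ℓ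
    NonOrthogonal p q = ¬ Orthogonal p q

    infix 4 _≤RK[_]_

    module _ (𝕄⁺ : LargerMonster 𝕄) where
      open LargerMonster 𝕄⁺

      Realizes : ∀ {Γ} → Env N Γ → GlobalType 𝕄 Γ → Set ℓ
      Realizes a p = ∀ {φ} → φ ∈ ⟦ p ⟧ → a ⊩ ι-formula φ

    _≤RK[_]_ : ∀ {Γ Δ} → GlobalType 𝕄 Γ → LargerMonster 𝕄 → GlobalType 𝕄 Δ → Set ℓ
    p ≤RK[ 𝕄⁺ ] q = ∃[ a ] ∃[ b ]
      Realizes 𝕄⁺ a p × Realizes 𝕄⁺ b q × a ∈ Sem (LargerMonster.N 𝕄⁺) (LargerMonster.base 𝕄⁺) b

{-# OPTIONS --safe #-}

-- By generic stability, compactness bounds the length n for which some χ(-, c̄) is false on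
-- the first half and true on the second half of a Morley sequence in p of length 2n.  Hence p
-- is definable by counting along one Morley sequence u, and p(x) ⊗ p(y) is symmetric.  As all
-- definitions use parameters from u only, strong regularity passes from small subsets of M to
-- M itself: if a ∈ φ(N) does not realize p, then a Morley sequence in p over M is one over Ma.
--
-- (1) Let θ(ȳ, x) ⊢ q with x realizing p.  If d_x ∃ȳ (θ(ȳ, x) ∧ θ(ȳ, z)) were in p(z), then by
-- symmetry some θ(ȳ, m) with m ∈ M would isolate q, making q algebraic.  So for b̄ satisfying
-- θ(ȳ, x), the formula φ(z) ∧ θ(b̄, z) ∧ ¬ d_x ∃ȳ (θ(ȳ, x) ∧ θ(ȳ, z)) isolates p: a solution a
-- outside p would be independent of x, and b̄ lies in both θ(ȳ, x) and θ(ȳ, a).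
--
-- (2) If p(x) ∪ q(ȳ) does not decide θ, then after replacing θ by its negation ¬ θ(m, ȳ) ∈ q
-- for all m in a long Morley sequence in M.  Were p ≰ q, every Morley sequence over M inside
-- θ(N, b̄) with b̄ realizing q could be prolonged: solutions of φ(x) ∧ θ(x, b̄) outside p, but
-- satisfying ever more of p, are independent of the sequence and converge to a new first term.
-- Long sequences contradict the bound n.

module Submission where

open import Defs
open import Axiom.ExcludedMiddle using (ExcludedMiddle)
open import Level using (Level)
open import Data.Empty using (⊥-elim)
open import Data.Empty.Polymorphic using () renaming (⊥ to ⊥ₚ; ⊥-elim to ⊥ₚ-elim)
open import Data.Fin.Base using (Fin; zero; suc; toℕ; fromℕ<)
open import Data.Fin.Properties using (toℕ-fromℕ<; toℕ-injective; toℕ<n)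
open import Data.List.Base using (List; []; _∷_; _++_)
open import Data.List.Membership.Propositional using () renaming (_∈_ to _∈ˡ_)
open import Data.List.Membership.Propositional.Properties using (∈-++⁺ˡ; ∈-++⁺ʳ)
open import Data.List.Membership.Setoid.Properties using (index-injective)
open import Data.List.Relation.Unary.All as All using (All; []; _∷_)
open import Data.List.Relation.Unary.All.Properties using (++⁺; map-id; lookup-map)
open import Data.List.Relation.Unary.Any using (here; there; index)
open import Data.Nat.Base using (ℕ; zero; suc; _+_; _≤_; _<_; s≤s) renaming (_⊔_ to _⊔ᴺ_)
open import Data.Nat.Induction using (<-wellFounded)
open import Data.Nat.Properties as ℕ using (≤-refl; ≤-trans; ≤∧≢⇒<; <-irrefl; <-trans; <-cmp; +-suc; +-identityʳ; suc-injective)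
open import Data.Product.Base using (Σ; ∃; ∃-syntax; _×_; _,_; proj₁; proj₂)
open import Data.Sum.Base using (_⊎_; inj₁; inj₂; [_,_]′; map₁)
open import Data.Sum.Properties using (inj₁-injective; inj₂-injective)
open import Data.Unit.Polymorphic using (⊤; tt)
open import Data.Vec.Base using (Vec; []; _∷_; lookup)
open import Function.Base using (_∘_; id)
open import Function.Bundles using (_⇔_; mk⇔; Equivalence; _↣_; mk↣; Injection)
open import Function.Construct.Composition using (_↣-∘_; _⇔-∘_)
open import Function.Construct.Identity using (⇔-id)
open import Induction.WellFounded using (WellFounded; Acc; acc)
open import Relation.Binary.Definitions using (Trichotomous; tri<; tri≈; tri>)
open import Relation.Binary.PropositionalEquality using (_≡_; refl; sym; trans; cong; cong₂; subst; isEquivalence; setoid)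
open import Relation.Binary.Structures using (IsStrictTotalOrder)
open import Relation.Nullary.Decidable.Core using (yes; no)
open import Relation.Nullary.Negation.Core using (¬_)
open import Relation.Unary using (Pred; _∈_; _⊆_; _∪_; _≐_; ｛_｝)

open Language using (Context)
open Structure using (Carrier)
open Equivalence using (to; from)
open PFormula using (formula; parameters)
open GlobalType using (⟦_⟧; consistent; complete)

-- Cardinality: adjoining a countable set to a small one

module _ where

  private
    variable
      a b c : Level
      A : Set a
      B : Set b
      C : Set c

  interleave : ℕ ⊎ ℕ → ℕ
  interleave (inj₁ n) = n + n
  interleave (inj₂ n) = suc (n + n)

  double-injective : ∀ m n → m + m ≡ n + n → m ≡ n
  double-injective zero    zero    _  = refl
  double-injective (suc m) (suc n) eq
    rewrite +-suc m m | +-suc n n = cong suc (double-injective m n (suc-injective (suc-injective eq)))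

  double≢odd : ∀ m n → ¬ m + m ≡ suc (n + n)
  double≢odd (suc m) zero    eq rewrite +-suc m m with () ← eq
  double≢odd (suc m) (suc n) eq
    rewrite +-suc m m | +-suc n n = double≢odd m n (suc-injective (suc-injective eq))

  interleave-injective : ∀ {x y} → interleave x ≡ interleave y → x ≡ y
  interleave-injective {inj₁ m} {inj₁ n} eq = cong inj₁ (double-injective m n eq)
  interleave-injective {inj₁ m} {inj₂ n} eq = ⊥-elim (double≢odd m n eq)
  interleave-injective {inj₂ m} {inj₁ n} eq = ⊥-elim (double≢odd n m (sym eq))
  interleave-injective {inj₂ m} {inj₂ n} eq = cong inj₂ (double-injective m n (suc-injective eq))

  ℕ⊎ℕ↣ℕ : (ℕ ⊎ ℕ) ↣ ℕ
  ℕ⊎ℕ↣ℕ = mk↣ {to = interleave} interleave-injective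

  ⊎-mapˡ-↣ : A ↣ B → (A ⊎ C) ↣ (B ⊎ C)
  ⊎-mapˡ-↣ {A = A} {B = B} {C = C} f = mk↣ {to = map₁ (Injection.to f)} inj
    where
    inj : ∀ {x y} → map₁ (Injection.to f) x ≡ map₁ (Injection.to f) y → x ≡ y
    inj {inj₁ x} {inj₁ y} eq = cong inj₁ (Injection.injective f (inj₁-injective eq))
    inj {inj₂ x} {inj₂ y} eq = cong inj₂ (inj₂-injective eq)

  ≺-respˡ-↣ : A ↣ B → B ≺ C → A ≺ C
  ≺-respˡ-↣ f (g , ¬h) = (g ↣-∘ f) , λ h → ¬h (f ↣-∘ h)

  module Cardinality (em : ∀ ℓ → ExcludedMiddle ℓ) where

    module _ {A : Set a} (f : ℕ ↣ A) where
      open Injection f using () renaming (to to f⟨_⟩; injective to f-injective)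

      private
        -- Hilbert's hotel: the copy of ℕ inside `A` retreats to its even places, which frees the
        -- odd ones for the summand ℕ; everything else stays fixed.
        hotel : A ⊎ ℕ → A
        hotel (inj₂ n) = f⟨ interleave (inj₂ n) ⟩
        hotel (inj₁ x) with em _ {∃[ n ] f⟨ n ⟩ ≡ x}
        ... | yes (n , _) = f⟨ interleave (inj₁ n) ⟩
        ... | no  _       = x

        hotel-injective : ∀ {x y} → hotel x ≡ hotel y → x ≡ y
        hotel-injective {inj₁ x} {inj₁ y} eq
          with em _ {∃[ n ] f⟨ n ⟩ ≡ x} | em _ {∃[ n ] f⟨ n ⟩ ≡ y}
        ... | yes (m , refl) | yes (n , refl) =
                cong (inj₁ ∘ f⟨_⟩) (inj₁-injective (interleave-injective {inj₁ m} {inj₁ n} (f-injective eq)))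
        ... | yes _          | no  ∄n         = ⊥-elim (∄n (_ , eq))
        ... | no  ∄m         | yes _          = ⊥-elim (∄m (_ , sym eq))
        ... | no  _          | no  _          = cong inj₁ eq
        hotel-injective {inj₁ x} {inj₂ n} eq with em _ {∃[ m ] f⟨ m ⟩ ≡ x}
        ... | yes (m , refl) = ⊥-elim (double≢odd m n (f-injective eq))
        ... | no  ∄m         = ⊥-elim (∄m (_ , sym eq))
        hotel-injective {inj₂ n} {inj₁ x} eq with em _ {∃[ m ] f⟨ m ⟩ ≡ x}
        ... | yes (m , refl) = ⊥-elim (double≢odd m n (f-injective (sym eq)))
        ... | no  ∄m         = ⊥-elim (∄m (_ , eq))
        hotel-injective {inj₂ m} {inj₂ n} eq =
          cong inj₂ (inj₂-injective (interleave-injective {inj₂ m} {inj₂ n} (f-injective eq)))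

      ⊎ℕ-absorb : (A ⊎ ℕ) ↣ A
      ⊎ℕ-absorb = mk↣ {to = hotel} hotel-injective

    -- If no list exhausts `A`, choosing again and again an element outside the list of earlier
    -- choices embeds ℕ.
    ℕ↣∨↣ℕ : (A : Set a) → (ℕ ↣ A) ⊎ (A ↣ ℕ)
    ℕ↣∨↣ℕ A with em _ {∃[ xs ] (∀ (x : A) → x ∈ˡ xs)}
    ... | yes (xs , all) =
            inj₂ (mk↣ {to = λ x → toℕ (index (all x))} (index-injective (setoid A) _ _ ∘ toℕ-injective))
    ... | no  ∄xs = inj₁ (mk↣ {to = pick} pick-injective)
      where
      fresh : (xs : List A) → ∃[ x ] ¬ x ∈ˡ xs
      fresh xs with em _ {∃[ x ] ¬ x ∈ˡ xs}
      ... | yes p = p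
      ... | no ¬p = ⊥-elim (∄xs (xs , all))
        where
        all : ∀ x → x ∈ˡ xs
        all x with em _ {x ∈ˡ xs}
        ... | yes p = p
        ... | no ¬q = ⊥-elim (¬p (x , ¬q))

      picked : ℕ → List A
      picked zero    = []
      picked (suc n) = proj₁ (fresh (picked n)) ∷ picked n

      pick : ℕ → A
      pick n = proj₁ (fresh (picked n))

      pick-∈ : ∀ {m n} → m < n → pick m ∈ˡ picked n
      pick-∈ {m} {suc n} (s≤s m≤n) with em _ {m ≡ n}
      ... | yes refl = here refl
      ... | no  m≢n  = there (pick-∈ (≤∧≢⇒< m≤n m≢n))

      pick-injective : ∀ {m n} → pick m ≡ pick n → m ≡ n
      pick-injective {m} {n} eq with <-cmp m n
      ... | tri< m<n _ _ = ⊥-elim (proj₂ (fresh (picked n)) (subst (_∈ˡ picked n) eq (pick-∈ m<n)))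
      ... | tri≈ _ m≡n _ = m≡n
      ... | tri> _ _ n<m = ⊥-elim (proj₂ (fresh (picked m)) (subst (_∈ˡ picked m) (sym eq) (pick-∈ n<m)))

    -- If ℕ embeds in `A`, then `A` absorbs the summand; otherwise `A ⊎ ℕ` embeds in ℕ, and `ℕ ≺ B`
    -- suffices.
    ⊎ℕ-≺ : ℕ ≺ B → A ≺ B → (A ⊎ ℕ) ≺ B
    ⊎ℕ-≺ {A = A} ℕ≺B A≺B with ℕ↣∨↣ℕ A
    ... | inj₁ f = ≺-respˡ-↣ (⊎ℕ-absorb f) A≺B
    ... | inj₂ g = ≺-respˡ-↣ (ℕ⊎ℕ↣ℕ ↣-∘ ⊎-mapˡ-↣ g) ℕ≺B

-- The ordinal ω + ω

data ω+ω (ℓ : Level) : Set ℓ where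
  fst snd : ℕ → ω+ω ℓ

data _<ω_ {ℓ} : ω+ω ℓ → ω+ω ℓ → Set ℓ where
  fst<fst : ∀ {m n} → m < n → fst m <ω fst n
  fst<snd : ∀ {m n} → fst m <ω snd n
  snd<snd : ∀ {m n} → m < n → snd m <ω snd n

module _ {ℓ : Level} where

  <ω-compare : Trichotomous _≡_ (_<ω_ {ℓ})
  <ω-compare (fst m) (fst n) with <-cmp m n
  ... | tri< a b c = tri< (fst<fst a) (λ { refl → b refl }) (λ { (fst<fst x) → c x })
  ... | tri≈ a b c = tri≈ (λ { (fst<fst x) → a x }) (cong fst b) (λ { (fst<fst x) → c x })
  ... | tri> a b c = tri> (λ { (fst<fst x) → a x }) (λ { refl → b refl }) (fst<fst c)
  <ω-compare (fst m) (snd n) = tri< fst<snd (λ ()) (λ ())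
  <ω-compare (snd m) (fst n) = tri> (λ ()) (λ ()) fst<snd
  <ω-compare (snd m) (snd n) with <-cmp m n
  ... | tri< a b c = tri< (snd<snd a) (λ { refl → b refl }) (λ { (snd<snd x) → c x })
  ... | tri≈ a b c = tri≈ (λ { (snd<snd x) → a x }) (cong snd b) (λ { (snd<snd x) → c x })
  ... | tri> a b c = tri> (λ { (snd<snd x) → a x }) (λ { refl → b refl }) (snd<snd c)

  <ω-isStrictTotalOrder : IsStrictTotalOrder _≡_ (_<ω_ {ℓ})
  <ω-isStrictTotalOrder = record
    { isStrictPartialOrder = record
      { isEquivalence = isEquivalence
      ; irrefl        = λ { refl (fst<fst x) → <-irrefl refl x ; refl (snd<snd x) → <-irrefl refl x }
      ; trans         = λ { (fst<fst x) (fst<fst y) → fst<fst (<-trans x y)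
                          ; (fst<fst x) fst<snd     → fst<snd
                          ; fst<snd     (snd<snd y) → fst<snd
                          ; (snd<snd x) (snd<snd y) → snd<snd (<-trans x y) }
      ; <-resp-≈      = (λ { refl x → x }) , (λ { refl x → x })
      }
    ; compare = <ω-compare
    }

  <ω-wellFounded : WellFounded (_<ω_ {ℓ})
  <ω-wellFounded (fst n) = fst-acc n (<-wellFounded n)
    where
    fst-acc : ∀ n → Acc _<_ n → Acc _<ω_ (fst n)
    fst-acc n (acc rs) = acc λ { (fst<fst x) → fst-acc _ (rs x) }
  <ω-wellFounded (snd n) = snd-acc n (<-wellFounded n)
    where
    snd-acc : ∀ n → Acc _<_ n → Acc _<ω_ (snd n)
    snd-acc n (acc rs) = acc λ { (fst<snd {m})   → <ω-wellFounded (fst m)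
                               ; (snd<snd x) → snd-acc _ (rs x) }

  -- Neither half fits into a list, so a subset that is exactly one of the halves is neither finite
  -- nor cofinite.
  ω-bounded : (xs : List (ω+ω ℓ)) → ∃[ k ] (∀ n → k ≤ n → ¬ (fst n ∈ˡ xs) × ¬ (snd n ∈ˡ xs))
  ω-bounded []       = 0 , λ _ _ → (λ ()) , (λ ())
  ω-bounded (x ∷ xs) with ω-bounded xs
  ω-bounded (fst m ∷ xs) | k , h = suc m ⊔ᴺ k , λ n le →
    (λ { (here refl) → <-irrefl refl (≤-trans (ℕ.m≤m⊔n (suc m) k) le)
       ; (there i)   → proj₁ (h n (≤-trans (ℕ.m≤n⊔m (suc m) k) le)) i }) ,
    (λ { (there i)   → proj₂ (h n (≤-trans (ℕ.m≤n⊔m (suc m) k) le)) i })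
  ω-bounded (snd m ∷ xs) | k , h = suc m ⊔ᴺ k , λ n le →
    (λ { (there i)   → proj₁ (h n (≤-trans (ℕ.m≤n⊔m (suc m) k) le)) i }) ,
    (λ { (here refl) → <-irrefl refl (≤-trans (ℕ.m≤m⊔n (suc m) k) le)
       ; (there i)   → proj₂ (h n (≤-trans (ℕ.m≤n⊔m (suc m) k) le)) i })

-- Renamings of contexts and their effect on environments

module _ {ℓ} {S : Set ℓ} where

  private
    variable
      Γ Δ Θ : List S
      t s : S

  Renaming : List S → List S → Set ℓ
  Renaming Γ Δ = ∀ {t} → t ∈ˡ Γ → t ∈ˡ Δ

  copair : Renaming Γ Θ → Renaming Δ Θ → Renaming (Γ ++ Δ) Θ
  copair {Γ = []}    f g v           = g v
  copair {Γ = _ ∷ Γ} f g (here refl) = f (here refl)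
  copair {Γ = _ ∷ Γ} f g (there v)   = copair {Γ = Γ} (f ∘ there) g v

  lift-ren : ∀ s → Renaming Γ Δ → Renaming (s ∷ Γ) (s ∷ Δ)
  lift-ren s ρ (here refl) = here refl
  lift-ren s ρ (there v)   = there (ρ v)

  module _ {P : S → Set ℓ} where

    -- A record rather than a bare family of equations, so that the renaming and both environments
    -- are determined by the type.
    record Along (ρ : Renaming Γ Δ) (e′ : All P Δ) (e : All P Γ) : Set ℓ where
      constructor along
      field
        at : ∀ {t} (v : t ∈ˡ Γ) → All.lookup e′ (ρ v) ≡ All.lookup e v

    open Along public

    lookup-++ˡ : (e : All P Γ) (d : All P Δ) → Along ∈-++⁺ˡ (++⁺ e d) e
    lookup-++ˡ []      d .at ()
    lookup-++ˡ (_ ∷ e) d .at (here refl) = refl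
    lookup-++ˡ (_ ∷ e) d .at (there v)   = lookup-++ˡ e d .at v

    lookup-++ʳ : (e : All P Γ) (d : All P Δ) → Along (∈-++⁺ʳ Γ) (++⁺ e d) d
    lookup-++ʳ []      d .at v = refl
    lookup-++ʳ (_ ∷ e) d .at v = lookup-++ʳ e d .at v

    Along-∘ : {ρ : Renaming Γ Δ} {σ : Renaming Δ Θ} {e : All P Γ} {e′ : All P Δ} {e″ : All P Θ} →
      Along σ e″ e′ → Along ρ e′ e → Along (σ ∘ ρ) e″ e
    Along-∘ {ρ = ρ} S R .at v = trans (S .at (ρ v)) (R .at v)

    Along-there : ∀ {s} {m : P s} {e : All P Γ} → Along there (m ∷ e) e
    Along-there .at v = refl

    lookup-copair : ∀ {f : Renaming Γ Θ} {g : Renaming Δ Θ} {e e₁ e₂} →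
      Along f e e₁ → Along g e e₂ → Along (copair f g) e (++⁺ e₁ e₂)
    lookup-copair {e₁ = []}     F G .at v           = G .at v
    lookup-copair {e₁ = _ ∷ e₁} F G .at (here refl) = F .at (here refl)
    lookup-copair {e₁ = _ ∷ e₁} F G .at (there v)   = lookup-copair (along {e = e₁} (F .at ∘ there)) G .at v

    lookup-lift : ∀ {s} {ρ : Renaming Γ Δ} {e′ e} (m : P s) →
      Along ρ e′ e → Along (lift-ren s ρ) (m ∷ e′) (m ∷ e)
    lookup-lift m A .at (here refl) = refl
    lookup-lift m A .at (there v)   = A .at v

    lookup-ext : (e e′ : All P Γ) → (∀ {t} (v : t ∈ˡ Γ) → All.lookup e v ≡ All.lookup e′ v) → e ≡ e′
    lookup-ext []      []        h = refl
    lookup-ext (m ∷ e) (m′ ∷ e′) h = cong₂ _∷_ (h (here refl)) (lookup-ext e e′ (h ∘ there))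

    ++-split : ∀ Γ (g : All P (Γ ++ Δ)) → ∃[ e ] ∃[ f ] g ≡ ++⁺ {xs = Γ} e f
    ++-split []      g       = [] , g , refl
    ++-split (_ ∷ Γ) (m ∷ g) with e , f , refl ← ++-split Γ g = m ∷ e , f , refl

  map-++⁺ : ∀ {P Q : S → Set ℓ} (j : ∀ {t} → P t → Q t)
    (e : All P Γ) (d : All P Δ) → All.map j (++⁺ e d) ≡ ++⁺ (All.map j e) (All.map j d)
  map-++⁺ j []      d = refl
  map-++⁺ j (m ∷ e) d = cong (j m ∷_) (map-++⁺ j e d)

-- Renaming, connectives and substitution for formulas with parameters

module _ {ℓ} {L : Language ℓ} where
  open Language L using (Sort)

  private
    variable
      Γ Γ′ Δ Θ : Context L
      t : Sort

  mutual
    renT : Renaming Γ Δ → Term L Γ t → Term L Δ t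
    renT ρ (var v)    = var (ρ v)
    renT ρ (app f ts) = app f (renTs ρ ts)

    renTs : ∀ {ss} → Renaming Γ Δ → All (Term L Γ) ss → All (Term L Δ) ss
    renTs ρ []       = []
    renTs ρ (t ∷ ts) = renT ρ t ∷ renTs ρ ts

  renF : Renaming Γ Δ → Formula L Γ → Formula L Δ
  renF ρ ⊥ᶠ          = ⊥ᶠ
  renF ρ (t ≐ᶠ u)    = renT ρ t ≐ᶠ renT ρ u
  renF ρ (relᶠ R ts) = relᶠ R (renTs ρ ts)
  renF ρ (φ ⇒ᶠ ψ)    = renF ρ φ ⇒ᶠ renF ρ ψ
  renF ρ (∀ᶠ s φ)    = ∀ᶠ s (renF (lift-ren s ρ) φ)

  -- A conjunction of equations between variables, with α ∧ β spelled as ¬ (α ⇒ ¬ β). It serves to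
  -- express x̄ = ē by a formula.
  equations : Renaming Γ Δ → Renaming Γ Δ → Formula L Δ
  equations {Γ = []}    ρ σ = ¬ᶠ ⊥ᶠ
  equations {Γ = s ∷ Γ} ρ σ =
    ¬ᶠ ((var (ρ (here refl)) ≐ᶠ var (σ (here refl))) ⇒ᶠ (¬ᶠ equations {Γ = Γ} (ρ ∘ there) (σ ∘ there)))

  module _ (K : Structure L) where

    module _ (ρ : Renaming Γ Δ) {e′ : Env K Δ} {e : Env K Γ} (A : Along ρ e′ e) where
      mutual
        eval-ren : (u : Term L Γ t) → eval K e′ (renT ρ u) ≡ eval K e u
        eval-ren (var v)    = A .at v
        eval-ren (app f ts) = cong (Structure.fun K f) (evals-ren ts)

        evals-ren : ∀ {ss} (us : All (Term L Γ) ss) → evals K e′ (renTs ρ us) ≡ evals K e us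
        evals-ren []       = refl
        evals-ren (u ∷ us) = cong₂ _∷_ (eval-ren u) (evals-ren us)

    ⊨-ren : (φ : Formula L Γ) (ρ : Renaming Γ Δ) {e′ : Env K Δ} {e : Env K Γ} →
      Along ρ e′ e → (K ⊨ renF ρ φ [ e′ ]) ⇔ (K ⊨ φ [ e ])
    ⊨-ren ⊥ᶠ          ρ A = mk⇔ id id
    ⊨-ren (u ≐ᶠ w)    ρ A rewrite eval-ren ρ A u | eval-ren ρ A w = mk⇔ id id
    ⊨-ren (relᶠ R us) ρ A rewrite evals-ren ρ A us = mk⇔ id id
    ⊨-ren (φ ⇒ᶠ ψ)    ρ A = mk⇔
      (λ h x → to (⊨-ren ψ ρ A) (h (from (⊨-ren φ ρ A) x)))
      (λ h x → from (⊨-ren ψ ρ A) (h (to (⊨-ren φ ρ A) x)))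
    ⊨-ren (∀ᶠ s φ)    ρ A = mk⇔
      (λ h m → to (⊨-ren φ (lift-ren s ρ) (lookup-lift m A)) (h m))
      (λ h m → from (⊨-ren φ (lift-ren s ρ) (lookup-lift m A)) (h m))

  module _ {K : Structure L} where

    Range-++ : (B : ParameterSet K) (e : Env K Γ) (d : Env K Δ) →
      Range K e ⊆ B → Range K d ⊆ B → Range K (++⁺ e d) ⊆ B
    Range-++ B []      d h k (v , eq)           = k (v , eq)
    Range-++ B (m ∷ e) d h k (here refl , refl) = h (here refl , refl)
    Range-++ B (m ∷ e) d h k (there v , eq)     = Range-++ B e d (λ (w , q) → h (there w , q)) k (v , eq)

    ⊥ᵖ : PFormula K Γ
    ⊥ᵖ = ⊥ᶠ ⟨ [] ⟩

    ⊤ᵖ : PFormula K Γ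
    ⊤ᵖ = ¬ᵖ ⊥ᵖ

    renᵖ : Renaming Γ Γ′ → PFormula K Γ → PFormula K Γ′
    renᵖ {Γ′ = Γ′} ρ (φ ⟨ d ⟩) = renF (copair (∈-++⁺ˡ ∘ ρ) (∈-++⁺ʳ Γ′)) φ ⟨ d ⟩

    ⊩-ren : (ρ : Renaming Γ Γ′) (φ : PFormula K Γ) {e′ : Env K Γ′} {e : Env K Γ} →
      Along ρ e′ e → (e′ ⊩ renᵖ ρ φ) ⇔ (e ⊩ φ)
    ⊩-ren ρ (φ ⟨ d ⟩) {e′} A = ⊨-ren K φ _
      (lookup-copair (Along-∘ (lookup-++ˡ e′ d) A) (lookup-++ʳ e′ d))

    infixr 5 _⇒ᵖ_

    _⇒ᵖ_ : PFormula K Γ → PFormula K Γ → PFormula K Γ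
    _⇒ᵖ_ {Γ = Γ} (_⟨_⟩ {Δ} φ d) (_⟨_⟩ {Δ′} ψ d′) =
      (renF (copair ∈-++⁺ˡ (∈-++⁺ʳ Γ ∘ ∈-++⁺ˡ {xs = Δ})) φ ⇒ᶠ
       renF (copair ∈-++⁺ˡ (∈-++⁺ʳ Γ ∘ ∈-++⁺ʳ Δ)) ψ) ⟨ ++⁺ d d′ ⟩

    ⇒-⊩ : ∀ (φ ψ : PFormula K Γ) {e} → (e ⊩ (φ ⇒ᵖ ψ)) ⇔ (e ⊩ φ → e ⊩ ψ)
    ⇒-⊩ (φ ⟨ d ⟩) (ψ ⟨ d′ ⟩) {e} = mk⇔
      (λ h x → to (⊨-ren K ψ _ Aψ) (h (from (⊨-ren K φ _ Aφ) x)))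
      (λ h x → from (⊨-ren K ψ _ Aψ) (h (to (⊨-ren K φ _ Aφ) x)))
      where
      Aφ = lookup-copair (lookup-++ˡ e (++⁺ d d′))
             (Along-∘ (lookup-++ʳ e (++⁺ d d′)) (lookup-++ˡ d d′))
      Aψ = lookup-copair (lookup-++ˡ e (++⁺ d d′))
             (Along-∘ (lookup-++ʳ e (++⁺ d d′)) (lookup-++ʳ d d′))

    infixr 6 _∧ᵖ_

    _∧ᵖ_ : PFormula K Γ → PFormula K Γ → PFormula K Γ
    φ ∧ᵖ ψ = ¬ᵖ (φ ⇒ᵖ ¬ᵖ ψ)

    impsᵖ : List (PFormula K Γ) → PFormula K Γ → PFormula K Γ
    impsᵖ []       ψ = ψ
    impsᵖ (φ ∷ φs) ψ = φ ⇒ᵖ impsᵖ φs ψ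

    imps-⊩ : ∀ (φs : List (PFormula K Γ)) ψ {e} → (e ⊩ impsᵖ φs ψ) ⇔ (All (e ⊩_) φs → e ⊩ ψ)
    imps-⊩ []       ψ = mk⇔ (λ h _ → h) (λ h → h [])
    imps-⊩ (φ ∷ φs) ψ = mk⇔
      (λ { h (x ∷ xs) → to (imps-⊩ φs ψ) (to (⇒-⊩ φ (impsᵖ φs ψ)) h x) xs })
      (λ h → from (⇒-⊩ φ (impsᵖ φs ψ)) λ x → from (imps-⊩ φs ψ) λ xs → h (x ∷ xs))

    infixl 7 _∙_

    _∙_ : ∀ {Θ} → PFormula K (Γ ++ Θ) → Env K Θ → PFormula K Γ
    _∙_ {Γ = Γ} {Θ} (_⟨_⟩ {Δ} φ d) c =
      renF (copair {Γ = Γ ++ Θ} {Δ = Δ} (copair {Γ = Γ} ∈-++⁺ˡ (∈-++⁺ʳ Γ ∘ ∈-++⁺ˡ)) (∈-++⁺ʳ Γ ∘ ∈-++⁺ʳ Θ)) φ ⟨ ++⁺ c d ⟩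

    ∙-⊩ : (φ : PFormula K (Γ ++ Θ)) (c : Env K Θ) {e : Env K Γ} → (e ⊩ φ ∙ c) ⇔ (++⁺ e c ⊩ φ)
    ∙-⊩ (φ ⟨ d ⟩) c {e} = ⊨-ren K φ _ (lookup-copair
      (lookup-copair (lookup-++ˡ e (++⁺ c d))
        (Along-∘ (lookup-++ʳ e (++⁺ c d)) (lookup-++ˡ c d)))
      (Along-∘ (lookup-++ʳ e (++⁺ c d)) (lookup-++ʳ c d)))

    ∀ᵖ : ∀ {s} → PFormula K (s ∷ Γ) → PFormula K Γ
    ∀ᵖ {s = s} (φ ⟨ d ⟩) = ∀ᶠ s φ ⟨ d ⟩

    ∀*ᵖ : ∀ Θ → PFormula K (Θ ++ Γ) → PFormula K Γ
    ∀*ᵖ []      φ = φ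
    ∀*ᵖ (s ∷ Θ) φ = ∀*ᵖ Θ (∀ᵖ φ)

    ∀*-⊩ : ∀ Θ (φ : PFormula K (Θ ++ Γ)) {e} → (e ⊩ ∀*ᵖ Θ φ) ⇔ (∀ c → ++⁺ {xs = Θ} c e ⊩ φ)
    ∀*-⊩ []      φ = mk⇔ (λ { h [] → h }) (λ h → h [])
    ∀*-⊩ (s ∷ Θ) φ = mk⇔
      (λ { h (m ∷ c) → to (∀*-⊩ Θ (∀ᵖ φ)) h c m })
      (λ h → from (∀*-⊩ Θ (∀ᵖ φ)) λ c m → h (m ∷ c))

    ∃*ᵖ : ∀ Θ → PFormula K (Θ ++ Γ) → PFormula K Γ
    ∃*ᵖ Θ φ = ¬ᵖ ∀*ᵖ Θ (¬ᵖ φ)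

    module _ {B : ParameterSet K} where

      Over-⇒ : (φ ψ : PFormula K Γ) → Over B φ → Over B ψ → Over B (φ ⇒ᵖ ψ)
      Over-⇒ φ ψ h k = Range-++ B (parameters φ) (parameters ψ) (λ r → h r) (λ r → k r)

      Over-∧ : (φ ψ : PFormula K Γ) → Over B φ → Over B ψ → Over B (φ ∧ᵖ ψ)
      Over-∧ φ ψ h k = Over-⇒ φ (¬ᵖ ψ) (λ r → h r) (λ r → k r)

      Over-∙ : (φ : PFormula K (Γ ++ Θ)) (c : Env K Θ) → Over B φ → Range K c ⊆ B → Over B (φ ∙ c)
      Over-∙ φ c h k = Range-++ B c (parameters φ) k (λ r → h r)

      Over-∀* : ∀ Θ (φ : PFormula K (Θ ++ Γ)) → Over B φ → Over B (∀*ᵖ Θ φ)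
      Over-∀* []      φ h = h
      Over-∀* (s ∷ Θ) φ h = Over-∀* Θ (∀ᵖ φ) (λ r → h r)

    pureᵖ : Formula L Γ → PFormula K Γ
    pureᵖ φ = renF ∈-++⁺ˡ φ ⟨ [] ⟩

    pure-⊩ : (φ : Formula L Γ) {e : Env K Γ} → (e ⊩ pureᵖ φ) ⇔ (K ⊨ φ [ e ])
    pure-⊩ φ {e} = ⊨-ren K φ ∈-++⁺ˡ (lookup-++ˡ e [])

    isᵖ : Env K Γ → PFormula K Γ
    isᵖ {Γ} e = equations {Γ = Γ} ∈-++⁺ˡ (∈-++⁺ʳ Γ) ⟨ e ⟩

  module Classical (em : ∀ ℓ′ → ExcludedMiddle ℓ′) where

    by-contradiction : ∀ {a} {P : Set a} → (¬ P → ⊥ₚ {ℓ}) → P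
    by-contradiction h with em _
    ... | yes p = p
    ... | no ¬p = ⊥ₚ-elim (h ¬p)

    module _ {K : Structure L} where

      ∧-⊩ : ∀ (φ ψ : PFormula K Γ) {e} → (e ⊩ φ ∧ᵖ ψ) ⇔ ((e ⊩ φ) × (e ⊩ ψ))
      ∧-⊩ φ ψ = mk⇔
        (λ h → by-contradiction (λ n → h (from (⇒-⊩ φ (¬ᵖ ψ)) λ x y → ⊥-elim (n x))) ,
               by-contradiction (λ n → h (from (⇒-⊩ φ (¬ᵖ ψ)) λ x y → ⊥-elim (n y))))
        (λ (x , y) h → to (⇒-⊩ φ (¬ᵖ ψ)) h x y)

      ∃*-⊩ : ∀ Θ (φ : PFormula K (Θ ++ Γ)) {e} → (e ⊩ ∃*ᵖ Θ φ) ⇔ (∃[ c ] (++⁺ {xs = Θ} c e ⊩ φ))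
      ∃*-⊩ Θ φ = mk⇔
        (λ h → by-contradiction λ n → h (from (∀*-⊩ Θ (¬ᵖ φ)) λ c x → ⊥-elim (n (c , x))))
        (λ (c , x) h → to (∀*-⊩ Θ (¬ᵖ φ)) h c x)

      equations-⊨ : ∀ (ρ σ : Renaming Γ Δ) {e : Env K Δ} → (K ⊨ equations ρ σ [ e ]) ⇔
        (∀ {t} (v : t ∈ˡ Γ) → All.lookup e (ρ v) ≡ All.lookup e (σ v))
      equations-⊨ {Γ = []}    ρ σ = mk⇔ (λ _ ()) (λ _ x → x)
      equations-⊨ {Γ = s ∷ Γ} ρ σ {e} = mk⇔
        (λ { h (here refl) → by-contradiction (λ n → h (λ q → ⊥-elim (n q)))
           ; h (there v)   → to (equations-⊨ (ρ ∘ there) (σ ∘ there))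
                               (by-contradiction (λ n → h (λ _ y → ⊥-elim (n y)))) v })
        (λ h g → g (h (here refl)) (from (equations-⊨ (ρ ∘ there) (σ ∘ there)) (λ v → h (there v))))

      is-⊩ : ∀ (c e : Env K Γ) → (e ⊩ isᵖ c) ⇔ (e ≡ c)
      is-⊩ {Γ} c e = mk⇔
        (λ h → lookup-ext e c λ v → trans (sym (lookup-++ˡ e c .at v))
                 (trans (to (equations-⊨ {Γ = Γ} ∈-++⁺ˡ (∈-++⁺ʳ Γ)) h v) (lookup-++ʳ e c .at v)))
        (λ { refl → from (equations-⊨ {Γ = Γ} ∈-++⁺ˡ (∈-++⁺ʳ Γ))
                 λ v → trans (lookup-++ˡ e c .at v) (sym (lookup-++ʳ e c .at v)) })

-- Moving parameters between structures; elementary extensions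

module _ {ℓ} {L : Language ℓ} where
  open Language L using (Sort)

  private
    variable
      Γ Γ′ Δ Θ : Context L
      t : Sort

  module _ {M K : Structure L} (j : ∀ {t} → Carrier M t → Carrier K t) where

    mapᵖ : PFormula M Γ → PFormula K Γ
    mapᵖ (φ ⟨ d ⟩) = φ ⟨ All.map j d ⟩

    map-⇒ : ∀ (φ ψ : PFormula M Γ) {e} → (e ⊩ mapᵖ (φ ⇒ᵖ ψ)) ⇔ (e ⊩ mapᵖ φ → e ⊩ mapᵖ ψ)
    map-⇒ φ@(_ ⟨ d ⟩) ψ@(_ ⟨ d′ ⟩)
      rewrite map-++⁺ j d d′ = ⇒-⊩ (mapᵖ φ) (mapᵖ ψ)

    map-imps : ∀ (φs : List (PFormula M Γ)) ψ {e} →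
      (e ⊩ mapᵖ (impsᵖ φs ψ)) ⇔ (All (λ φ → e ⊩ mapᵖ φ) φs → e ⊩ mapᵖ ψ)
    map-imps []       ψ = mk⇔ (λ h _ → h) (λ h → h [])
    map-imps (φ ∷ φs) ψ = mk⇔
      (λ { h (x ∷ xs) → to (map-imps φs ψ) (to (map-⇒ φ (impsᵖ φs ψ)) h x) xs })
      (λ h → from (map-⇒ φ (impsᵖ φs ψ)) λ x → from (map-imps φs ψ) λ xs → h (x ∷ xs))

    -- A tuple of parameters from j B ∪ f̄ splits into a tuple from B and variables for f̄.
    split-parameters : (B : ParameterSet M) (f : Env K Γ′) (d : Env K Δ) →
      (∀ {t} (v : t ∈ˡ Δ) → (∃[ m ] (t , m) ∈ B × j m ≡ All.lookup d v) ⊎ (t , All.lookup d v) ∈ Range K f) →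
      ∃[ Θ ] Σ (Env M Θ) λ d′ → Range M d′ ⊆ B ×
        Σ (Renaming Δ (Γ′ ++ Θ)) λ ρ → Along ρ (++⁺ f (All.map j d′)) d
    split-parameters B f [] h = [] , [] , (λ ()) , (λ ()) , along λ ()
    split-parameters {Γ′ = Γ′} B f (_∷_ {x = t} {xs = Δ} m d) h
      with split-parameters B f d (λ v → h (there v)) | h (here refl)
    ... | Θ , d′ , d′⊆B , ρ , A | inj₁ (b , b∈B , refl) =
          t ∷ Θ , b ∷ d′ , (λ { (here refl , refl) → b∈B ; (there v , eq) → d′⊆B (v , eq) }) ,
          ρ′ , along λ { (here refl) → lookup-++ʳ f (j b ∷ All.map j d′) .at (here refl)
                       ; (there v) → trans (S .at (ρ v)) (A .at v) }
      where
      σ : Renaming (Γ′ ++ Θ) (Γ′ ++ t ∷ Θ)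
      σ = copair {Γ = Γ′} ∈-++⁺ˡ (∈-++⁺ʳ Γ′ ∘ there)
      S : Along σ (++⁺ f (j b ∷ All.map j d′)) (++⁺ f (All.map j d′))
      S = lookup-copair (lookup-++ˡ f _) (Along-∘ (lookup-++ʳ f (j b ∷ All.map j d′)) (Along-there))
      ρ′ : Renaming (t ∷ Δ) (Γ′ ++ t ∷ Θ)
      ρ′ (here refl) = ∈-++⁺ʳ Γ′ (here refl)
      ρ′ (there v)   = σ (ρ v)
    ... | Θ , d′ , d′⊆B , ρ , A | inj₂ (w , eq) =
          Θ , d′ , d′⊆B , ρ′ ,
          along λ { (here refl) → trans (lookup-++ˡ f _ .at w) eq ; (there v) → A .at v }
      where
      ρ′ : Renaming (t ∷ Δ) (Γ′ ++ Θ)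
      ρ′ (here refl) = ∈-++⁺ˡ w
      ρ′ (there v)   = ρ v

    -- With `j` the embedding of M in N, a formula over M b̄ becomes a formula over M evaluated at
    -- b̄; with `j` the identity, a tuple is separated from the set `B`.
    normal-form : (B : ParameterSet M) (f : Env K Γ′) (ψ : PFormula K Γ) →
      (∀ {t n} → (t , n) ∈ Range K (parameters ψ) →
         (∃[ m ] (t , m) ∈ B × j m ≡ n) ⊎ (t , n) ∈ Range K f) →
      Σ (PFormula M (Γ ++ Γ′)) λ ξ → Over B ξ × (∀ e → (e ⊩ ψ) ⇔ (++⁺ e f ⊩ mapᵖ ξ))
    normal-form {Γ′ = Γ′} {Γ = Γ} B f (ψ ⟨ d ⟩) h
      with Θ , d′ , d′⊆B , ρ , A ← split-parameters B f d (λ v → h (v , refl)) =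
        renF τ ψ ⟨ d′ ⟩ , (λ r → d′⊆B r) , λ e →

          mk⇔ (from (⊨-ren K ψ τ (T e))) (to (⊨-ren K ψ τ (T e)))
      where
      σ : Renaming (Γ′ ++ Θ) ((Γ ++ Γ′) ++ Θ)
      σ = copair (∈-++⁺ˡ ∘ ∈-++⁺ʳ Γ) (∈-++⁺ʳ (Γ ++ Γ′))
      τ : Renaming (Γ ++ _) ((Γ ++ Γ′) ++ Θ)
      τ = copair (∈-++⁺ˡ ∘ ∈-++⁺ˡ) (σ ∘ ρ)
      T : ∀ e → Along τ (++⁺ (++⁺ e f) (All.map j d′)) (++⁺ e d)
      T e = lookup-copair
        (Along-∘ (lookup-++ˡ (++⁺ e f) _) (lookup-++ˡ e f))
        (Along-∘
          (lookup-copair (Along-∘ (lookup-++ˡ (++⁺ e f) _) (lookup-++ʳ e f)) (lookup-++ʳ (++⁺ e f) _))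
          A)

  module Extension (em : ∀ ℓ′ → ExcludedMiddle ℓ′)
    {M N : Structure L} (embedding : ElementaryEmbedding M N) where
    open ElementaryEmbedding embedding
    open Classical {L = L} em

    private
      ιᵖ : PFormula M Γ → PFormula N Γ
      ιᵖ = mapᵖ ι

    infix 4 _⊩ᴺ_

    _⊩ᴺ_ : Env N Γ → PFormula M Γ → Set ℓ
    e ⊩ᴺ φ = e ⊩ ιᵖ φ

    ι-⊩ : ∀ (φ : PFormula M Γ) e → (e ⊩ φ) ⇔ (All.map ι e ⊩ᴺ φ)
    ι-⊩ (φ ⟨ d ⟩) e rewrite sym (map-++⁺ ι e d) = elementary φ (++⁺ e d)

    -- The universal closure of `φ` has no free variables, so elementarity is needed at the empty
    -- tuple only; each step of the recursion quantifies one variable.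
    transfer : (φ : PFormula M Γ) → (∀ e → e ⊩ φ) → ∀ e → e ⊩ᴺ φ
    transfer φ h []      = to (ι-⊩ φ []) (h [])
    transfer φ h (m ∷ e) = transfer (∀ᵖ φ) (λ e m → h (m ∷ e)) e m

    ∧-⊩ᴺ : ∀ (φ ψ : PFormula M Γ) {e} → (e ⊩ᴺ φ ∧ᵖ ψ) ⇔ ((e ⊩ᴺ φ) × (e ⊩ᴺ ψ))
    ∧-⊩ᴺ φ@(_ ⟨ d ⟩) ψ@(_ ⟨ d′ ⟩)
      rewrite map-++⁺ ι d d′ = ∧-⊩ (ιᵖ φ) (ιᵖ ψ)

    -- If `φs` had no solution in M, the implication from `φs` to ⊥ would be valid in M, hence in N.
    reflect : ∀ (φs : List (PFormula M Γ)) e → All (e ⊩ᴺ_) φs → ∃[ e′ ] All (e′ ⊩_) φs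
    reflect φs e h = by-contradiction λ n →
      to (map-imps ι φs ⊥ᵖ) (transfer (impsᵖ φs ⊥ᵖ)
        (λ e′ → from (imps-⊩ φs ⊥ᵖ) λ h′ → ⊥-elim (n (e′ , h′))) e) h

-- Contexts that carry a finite sequence of elements of one sort

module _ {ℓ} {S : Set ℓ} where

  private
    variable
      Γ Θ : List S
      s : S

  -- The element of xs with index 0 is the innermost variable: a sequence is
  -- appended to a context in the order in which it is realized.
  rep : S → ℕ → List S → List S
  rep s zero    Γ = Γ
  rep s (suc k) Γ = rep s k (s ∷ Γ)

  weaken : ∀ k → Renaming Γ (rep s k Γ)
  weaken zero    v = v
  weaken (suc k) v = weaken k (there v)

  position : ∀ {k} → Fin k → s ∈ˡ rep s k Γ
  position {k = suc k} zero    = weaken k (here refl)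
  position {k = suc k} (suc i) = position i

  -- Turns a formula θ(x, ȳ) into the statement that θ holds of ȳ and the term of a sequence
  -- standing at the variable `v`.
  select : s ∈ˡ Γ → Renaming (s ∷ Θ) (Θ ++ Γ)
  select {Θ = Θ} v (here refl) = ∈-++⁺ʳ Θ v
  select {Θ = Θ} v (there w)   = ∈-++⁺ˡ w

  module _ {P : S → Set ℓ} where

    infixr 5 _⊕_

    _⊕_ : ∀ {k} → Vec (P s) k → All P Γ → All P (rep s k Γ)
    []       ⊕ f = f
    (x ∷ xs) ⊕ f = xs ⊕ (x ∷ f)

    ⊕-split : ∀ k (g : All P (rep s k Γ)) → Σ (Vec (P s) k) λ xs → ∃[ f ] g ≡ xs ⊕ f
    ⊕-split zero    g = [] , g , refl
    ⊕-split {s = s} (suc k) g with xs , x ∷ f , refl ← ⊕-split {s = s} k g = x ∷ xs , f , refl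

    lookup-weaken : ∀ {k} (xs : Vec (P s) k) (f : All P Γ) → Along (weaken {s = s} k) (xs ⊕ f) f
    lookup-weaken []       f .at v = refl
    lookup-weaken (x ∷ xs) f .at v = lookup-weaken xs (x ∷ f) .at (there v)

    lookup-position : ∀ {k} (xs : Vec (P s) k) (f : All P Γ) i →
      All.lookup (xs ⊕ f) (position i) ≡ lookup xs i
    lookup-position (x ∷ xs) f zero    = lookup-weaken xs (x ∷ f) .at (here refl)
    lookup-position (x ∷ xs) f (suc i) = lookup-position xs (x ∷ f) i

    lookup-select : (c : All P Θ) (e : All P Γ) (v : s ∈ˡ Γ) →
      Along (select v) (++⁺ c e) (All.lookup e v ∷ c)
    lookup-select c e v .at (here refl) = lookup-++ʳ c e .at v
    lookup-select c e v .at (there w)   = lookup-++ˡ c e .at w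

module _ {ℓ} {L : Language ℓ} where
  open Language L using (Sort)

  private
    variable
      Γ : Context L
      s : Sort

  module _ {K : Structure L} where

    Range-⊕⁻ : ∀ {k} (xs : Vec (Carrier K s) k) (f : Env K Γ) {B : ParameterSet K} →
      Range K f ⊆ B → (∀ i → (s , lookup xs i) ∈ B) → Range K (xs ⊕ f) ⊆ B
    Range-⊕⁻ []       f h g r = h r
    Range-⊕⁻ (x ∷ xs) f h g r = Range-⊕⁻ xs (x ∷ f) (λ { (here refl , refl) → g zero ; (there v , eq) → h (v , eq) }) (g ∘ suc) r

    atᵖ : Carrier K s → PFormula K (s ∷ Γ) → PFormula K Γ
    atᵖ m χ = renᵖ (select (here refl)) χ ∙ (m ∷ [])

    at-⊩ : ∀ (m : Carrier K s) (χ : PFormula K (s ∷ Γ)) {e} → (e ⊩ atᵖ m χ) ⇔ (m ∷ e ⊩ χ)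
    at-⊩ m χ {e} = ⊩-ren (select (here refl)) χ (lookup-select e (m ∷ []) (here refl))
      ⇔-∘ ∙-⊩ (renᵖ (select (here refl)) χ) (m ∷ [])

    Over-at : ∀ {B : ParameterSet K} m (χ : PFormula K (s ∷ Γ)) → (s , m) ∈ B → Over B χ → Over B (atᵖ m χ)
    Over-at {Γ = Γ} m χ m∈B h =
      Over-∙ {Γ = Γ} (renᵖ (select (here refl)) χ) (m ∷ []) (λ r → h r) (λ { (here refl , refl) → m∈B })

    -- The special case of _∙_ in the form used by InvariantOver, where no renaming is needed.
    infixl 7 _∙ᵗ_

    _∙ᵗ_ : PFormula K (s ∷ Γ) → Env K Γ → PFormula K (s ∷ [])
    χ ∙ᵗ c = formula χ ⟨ ++⁺ c (parameters χ) ⟩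

-- Small sets, global types and Morley sequences in M

module Monster {ℓ} (em : ∀ ℓ′ → ExcludedMiddle ℓ′) {L : Language ℓ} {T : Theory L} (𝕄 : MonsterModel T) where
  open Language L using (Sort)
  open MonsterModel 𝕄 renaming (structure to M)
  open Classical {L = L} em
  open Cardinality em

  private
    variable
      Γ : Context L
      t s : Sort
      A C C′ : ParameterSet M

  Countable : ParameterSet M → Set ℓ
  Countable C = Σ (ℕ → Element M) λ g → ∀ {m} → m ∈ C → ∃[ i ] g i ≡ m

  small-∪ : Small A → Countable C → Small (A ∪ C)
  small-∪ (I , I≺κ , enum , h) (g , k) = (I ⊎ ℕ) , ⊎ℕ-≺ uncountable I≺κ ,
    (λ { (inj₁ i) → enum i ; (inj₂ n) → g n }) ,
    λ { (inj₁ x) → let i , eq = h x in inj₁ i , eq ; (inj₂ x) → let n , eq = k x in inj₂ n , eq }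

  module _ (x₀ : Element M) where

    nth : List (Element M) → ℕ → Element M
    nth []       _       = x₀
    nth (x ∷ xs) zero    = x
    nth (x ∷ xs) (suc n) = nth xs n

    list-countable : ∀ xs → Countable (_∈ˡ xs)
    list-countable xs = nth xs , cover xs
      where
      cover : ∀ xs {x} → x ∈ˡ xs → ∃[ i ] nth xs i ≡ x
      cover (x ∷ xs) (here refl) = zero , refl
      cover (x ∷ xs) (there v)   = let i , eq = cover xs v in suc i , eq

    Range-countable : (e : Env M Γ) → Countable (Range M e)
    Range-countable e = nth (elements e) , λ { (v , refl) → proj₂ (list-countable (elements e)) (∈-elements e v) }
      where
      elements : Env M Γ → List (Element M)
      elements []      = []
      elements (m ∷ e) = (_ , m) ∷ elements e
      ∈-elements : ∀ (e : Env M Γ) {t} (v : t ∈ˡ Γ) → (t , All.lookup e v) ∈ˡ elements e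
      ∈-elements (m ∷ e) (here refl) = here refl
      ∈-elements (m ∷ e) (there v)   = there (∈-elements e v)

  module _ (q : GlobalType 𝕄 Γ) where

    -- Otherwise the negation of `ψ` would belong to `q` along with `φs`, against consistency.
    entails : ∀ φs ψ → All ⟦ q ⟧ φs → (∀ e → All (e ⊩_) φs → e ⊩ ψ) → ψ ∈ ⟦ q ⟧
    entails φs ψ h k with complete q ψ
    ... | inj₁ x = x
    ... | inj₂ y with consistent q (¬ᵖ ψ ∷ φs) (y ∷ h)
    ... | e , n ∷ hs = ⊥ₚ-elim (n (k e hs))

    ∉⇒¬∈ : ∀ ψ → ¬ (ψ ∈ ⟦ q ⟧) → (¬ᵖ ψ) ∈ ⟦ q ⟧
    ∉⇒¬∈ ψ n with complete q ψ
    ... | inj₁ x = ⊥-elim (n x)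
    ... | inj₂ y = y

    ∧-∈ : ∀ {φ ψ} → φ ∈ ⟦ q ⟧ → ψ ∈ ⟦ q ⟧ → (φ ∧ᵖ ψ) ∈ ⟦ q ⟧
    ∧-∈ {φ} {ψ} x y = entails (φ ∷ ψ ∷ []) (φ ∧ᵖ ψ) (x ∷ y ∷ [])
      λ { e (h ∷ k ∷ []) → from (∧-⊩ φ ψ) (h , k) }

    realize : Small C → ∃[ e ] e ⊩* q ↾ C
    realize sm = saturated sm (q ↾ _) proj₂ λ φs h → consistent q φs (All.map proj₁ h)

    -- The formula x̄ = ē belongs to `q`, since ē does not satisfy its negation, and it has a single
    -- solution.
    realized⇒algebraic : ∀ e → e ⊩* ⟦ q ⟧ → ¬ NonAlgebraic q
    realized⇒algebraic e h n = n e∈q (e ∷ [] , λ {e′} k → here (to (is-⊩ e e′) k))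
      where
      e∈q : isᵖ e ∈ ⟦ q ⟧
      e∈q with complete q (isᵖ e)
      ... | inj₁ x = x
      ... | inj₂ y = ⊥ₚ-elim (h y (from (is-⊩ e e) refl))

  module Morley (p : GlobalType 𝕄 (s ∷ [])) where

    private
      x₀ : Element M
      x₀ = s , Structure.nonempty M s

    infix 4 _⊨↾_

    _⊨↾_ : Carrier M s → ParameterSet M → Set ℓ
    x ⊨↾ C = (x ∷ []) ⊩* p ↾ C

    ⊨↾-antitone : ∀ {x} → C ⊆ C′ → x ⊨↾ C′ → x ⊨↾ C
    ⊨↾-antitone C⊆C′ h (x , o) = h (x , λ r → C⊆C′ (o r))

    Mor : ∀ {k} → ParameterSet M → Vec (Carrier M s) k → Set ℓ
    Mor C []       = ⊤
    Mor C (x ∷ xs) = x ⊨↾ C × Mor (C ∪ ｛ s , x ｝) xs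

    Mor-antitone : ∀ {k} (xs : Vec (Carrier M s) k) → C ⊆ C′ → Mor C′ xs → Mor C xs
    Mor-antitone []       C⊆C′ _        = tt
    Mor-antitone (x ∷ xs) C⊆C′ (h , hs) =
      ⊨↾-antitone C⊆C′ h ,
      Mor-antitone xs (λ { (inj₁ c) → inj₁ (C⊆C′ c) ; (inj₂ eq) → inj₂ eq }) hs

    Mor-⊨↾ : ∀ {k} (xs : Vec (Carrier M s) k) → Mor C xs → ∀ i → lookup xs i ⊨↾ C
    Mor-⊨↾ (x ∷ xs) (h , hs) zero    = h
    Mor-⊨↾ (x ∷ xs) (h , hs) (suc i) = Mor-⊨↾ xs (Mor-antitone xs inj₁ hs) i

    Before : (ℕ → Carrier M s) → ℕ → ParameterSet M
    Before u i m = ∃[ j ] j < i × (s , u j) ≡ m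

    Image : (ℕ → Carrier M s) → ParameterSet M
    Image u m = ∃[ j ] (s , u j) ≡ m

    Image-countable : ∀ u → Countable (Image u)
    Image-countable u = (λ i → s , u i) , id

    -- Each term realizes `p` over `C` and the finite list `history` of earlier terms, so that
    -- saturation always applies to a small set.
    infinite-Mor : Small C → ∃[ u ] (∀ i → u i ⊨↾ C ∪ Before u i)
    infinite-Mor {C} sm = u , λ i → ⊨↾-antitone
      (λ { (inj₁ c) → inj₁ c ; (inj₂ (j , j<i , refl)) → inj₂ (∈-history j<i) }) (proj₂ (next (history i)))
      where
      next : ∀ xs → ∃[ x ] x ⊨↾ C ∪ (_∈ˡ xs)
      next xs with realize p (small-∪ sm (list-countable x₀ xs))
      ... | x ∷ [] , h = x , h

      history : ℕ → List (Element M)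
      history zero    = []
      history (suc n) = (s , proj₁ (next (history n))) ∷ history n

      u : ℕ → Carrier M s
      u n = proj₁ (next (history n))

      ∈-history : ∀ {j i} → j < i → (s , u j) ∈ˡ history i
      ∈-history {j} {suc i} (s≤s j≤i) with ℕ.m≤n⇒m<n∨m≡n j≤i
      ... | inj₁ j<i  = there (∈-history j<i)
      ... | inj₂ refl = here refl

    segment : (ℕ → Carrier M s) → ℕ → ∀ k → Vec (Carrier M s) k
    segment u i zero    = []
    segment u i (suc k) = u i ∷ segment u (suc i) k

    lookup-segment : ∀ u i k (v : Fin k) → lookup (segment u i k) v ≡ u (i + toℕ v)
    lookup-segment u i (suc k) zero    = cong u (sym (+-identityʳ i))
    lookup-segment u i (suc k) (suc v) = trans (lookup-segment u (suc i) k v) (cong u (sym (+-suc i (toℕ v))))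

    segment-Mor : ∀ {u} → (∀ i → u i ⊨↾ C ∪ Before u i) →
      ∀ i k → C′ ⊆ C ∪ Before u i → Mor C′ (segment u i k)
    segment-Mor h i zero    _  = tt
    segment-Mor {C = C} {C′} {u} h i (suc k) C′⊆ = ⊨↾-antitone C′⊆ (h i) , segment-Mor h (suc i) k
      λ { (inj₁ c) → shift (C′⊆ c) ; (inj₂ refl) → inj₂ (i , ≤-refl , refl) }
      where
      shift : ∀ {m} → m ∈ C ∪ Before u i → m ∈ C ∪ Before u (suc i)
      shift (inj₁ c)              = inj₁ c
      shift (inj₂ (j , j<i , eq)) = inj₂ (j , ℕ.m≤n⇒m≤1+n j<i , eq)

    segment₀-Mor : ∀ {u} → (∀ i → u i ⊨↾ C ∪ Before u i) → ∀ k → Mor C (segment u 0 k)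
    segment₀-Mor h k = segment-Mor h 0 k inj₁

    Same : ParameterSet M → Env M Γ → Env M Γ → Set ℓ
    Same A f g = ∀ (φ : PFormula M _) → (∀ m → m ∈ Range M (parameters φ) → m ∈ A) → (f ⊩ φ) ⇔ (g ⊩ φ)

    Range-∷ : ∀ (f : Env M Γ) {x : Carrier M s} → Range M f ⊆ C → Range M (x ∷ f) ⊆ C ∪ ｛ s , x ｝
    Range-∷ f h (here refl , refl) = inj₂ refl
    Range-∷ f h (there v , eq)     = inj₁ (h (v , eq))

    module _ {A} (A-inv : InvariantOver A p) where

      -- As x realizes `p` over `C`, which contains f̄, a formula true of (x, f̄) is in `p`.
      -- Invariance replaces f̄ by ḡ, and y realizes `p` over `C′`, which contains ḡ.
      tp-∷ : ∀ (f g : Env M Γ) {x y} → A ⊆ C → Range M f ⊆ C → A ⊆ C′ → Range M g ⊆ C′ →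
        Same A f g → x ⊨↾ C → y ⊨↾ C′ →
        ∀ (φ : PFormula M _) → (∀ m → m ∈ Range M (parameters φ) → m ∈ A) → (x ∷ f) ⊩ φ → (y ∷ g) ⊩ φ
      tp-∷ {C = C} {C′} f g {x} {y} A⊆C f⊆C A⊆C′ g⊆C′ f≡g hx hy (ψ ⟨ d ⟩) o k =
        hy {ψ ⟨ ++⁺ g d ⟩} (to (A-inv ψ d (λ r → o _ r) f g f≐g) ψf∈p , Range-++ {K = M} C′ g d g⊆C′ (λ r → A⊆C′ (o _ r)))
        where
        f≐g : tp M f A ≐ tp M g A
        f≐g = (λ {φ} (o , h) → (λ {m} r → o r) , to (f≡g φ (λ m r → o r)) h) ,
              (λ {φ} (o , h) → (λ {m} r → o r) , from (f≡g φ (λ m r → o r)) h)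
        ψf∈p : (ψ ⟨ ++⁺ f d ⟩) ∈ ⟦ p ⟧
        ψf∈p with complete p (ψ ⟨ ++⁺ f d ⟩)
        ... | inj₁ z = z
        ... | inj₂ z = ⊥ₚ-elim (hx (z , Range-++ {K = M} C f d f⊆C (λ r → A⊆C (o _ r))) k)

      -- Iterates `tp-∷`, the bases growing with each term. `C` and `C′` are unrelated, so sequences
      -- over different extensions of `A` can be compared.
      tp-⊕ : ∀ {k} (f g : Env M Γ) (xs ys : Vec (Carrier M s) k) →
        A ⊆ C → Range M f ⊆ C → A ⊆ C′ → Range M g ⊆ C′ →
        Same A f g → Mor C xs → Mor C′ ys → Same A (xs ⊕ f) (ys ⊕ g)
      tp-⊕ f g []       []       _ _ _ _ f≡g _ _ = f≡g
      tp-⊕ {C = C} {C′} f g (x ∷ xs) (y ∷ ys) A⊆C f⊆C A⊆C′ g⊆C′ f≡g (hx , hxs) (hy , hys) =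
        tp-⊕ {C = C ∪ ｛ s , x ｝} {C′ ∪ ｛ s , y ｝} (x ∷ f) (y ∷ g) xs ys
          (λ r → inj₁ (A⊆C r)) (Range-∷ {C = C} f f⊆C) (λ r → inj₁ (A⊆C′ r)) (Range-∷ {C = C′} g g⊆C′)
          xf≡yg hxs hys
        where
        g≡f : Same A g f
        g≡f φ o = mk⇔ (from (f≡g φ o)) (to (f≡g φ o))
        xf≡yg : Same A (x ∷ f) (y ∷ g)
        xf≡yg φ o = mk⇔
          (tp-∷ {C = C} {C′} f g {x} {y} A⊆C f⊆C A⊆C′ g⊆C′ f≡g hx hy φ o)
          (tp-∷ {C = C′} {C} g f {y} {x} A⊆C′ g⊆C′ A⊆C f⊆C g≡f hy hx φ o)

-- Realizing types over M in N, and pulling tuples of N back to M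

module _ {ℓ} {S : Set ℓ} {P : S → Set ℓ} where

  restrict : ∀ {Γ Δ : List S} → Renaming Γ Δ → All P Δ → All P Γ
  restrict {[]}    ρ e = []
  restrict {s ∷ Γ} ρ e = All.lookup e (ρ (here refl)) ∷ restrict (ρ ∘ there) e

  lookup-restrict : ∀ {Γ Δ : List S} (ρ : Renaming Γ Δ) (e : All P Δ) → Along ρ e (restrict ρ e)
  lookup-restrict ρ e .at (here refl) = refl
  lookup-restrict ρ e .at (there v)   = lookup-restrict (ρ ∘ there) e .at v

module Larger {ℓ} (em : ∀ ℓ′ → ExcludedMiddle ℓ′) {L : Language ℓ} {T : Theory L} (𝕄 : MonsterModel T)
  (𝕄⁺ : LargerMonster 𝕄) where
  open Language L using (Sort)
  open MonsterModel 𝕄 renaming (structure to M)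
  open Classical {L = L} em
  open Monster em 𝕄
  open LargerMonster 𝕄⁺
  open Extension em embedding

  private
    variable
      Γ Γ′ Δ Θ : Context L
      t s : Sort
      B : ParameterSet M

  ren-⊩ᴺ : (ρ : Renaming Γ Γ′) (φ : PFormula M Γ) {e′ : Env N Γ′} {e : Env N Γ} →
    Along ρ e′ e → (e′ ⊩ᴺ renᵖ ρ φ) ⇔ (e ⊩ᴺ φ)
  ren-⊩ᴺ ρ φ = ⊩-ren ρ (ι-formula φ)

  ⇒-⊩ᴺ : ∀ (φ ψ : PFormula M Γ) {e} → (e ⊩ᴺ (φ ⇒ᵖ ψ)) ⇔ (e ⊩ᴺ φ → e ⊩ᴺ ψ)
  ⇒-⊩ᴺ = map-⇒ ι

  ∀*-⊩ᴺ : ∀ Θ (φ : PFormula M (Θ ++ Γ)) {e} → (e ⊩ᴺ ∀*ᵖ Θ φ) ⇔ (∀ (c : Env N Θ) → ++⁺ c e ⊩ᴺ φ)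
  ∀*-⊩ᴺ []      φ = mk⇔ (λ { h [] → h }) (λ h → h [])
  ∀*-⊩ᴺ (s ∷ Θ) φ = mk⇔
    (λ { h (m ∷ c) → to (∀*-⊩ᴺ Θ (∀ᵖ φ)) h c m })
    (λ h → from (∀*-⊩ᴺ Θ (∀ᵖ φ)) λ c m → h (m ∷ c))

  ∃*-⊩ᴺ : ∀ Θ (φ : PFormula M (Θ ++ Γ)) {e} → (e ⊩ᴺ ∃*ᵖ Θ φ) ⇔ (Σ (Env N Θ) λ c → ++⁺ c e ⊩ᴺ φ)
  ∃*-⊩ᴺ Θ φ = mk⇔
    (λ h → by-contradiction λ n → h (from (∀*-⊩ᴺ Θ (¬ᵖ φ)) λ c x → ⊥-elim (n (c , x))))
    (λ (c , x) h → to (∀*-⊩ᴺ Θ (¬ᵖ φ)) h c x)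

  ∙-⊩ᴺ : (φ : PFormula M (Γ ++ Θ)) (c : Env M Θ) {e : Env N Γ} →
    (e ⊩ᴺ φ ∙ c) ⇔ (++⁺ e (All.map ι c) ⊩ᴺ φ)
  ∙-⊩ᴺ φ@(_ ⟨ d ⟩) c rewrite map-++⁺ ι c d = ∙-⊩ (ι-formula φ) (All.map ι c)

  ⋀ᵖ : List (PFormula M Γ) → PFormula M Γ
  ⋀ᵖ φs = ¬ᵖ impsᵖ φs ⊥ᵖ

  ⋀-⊩ : ∀ (φs : List (PFormula M Γ)) {e} → (e ⊩ ⋀ᵖ φs) ⇔ All (e ⊩_) φs
  ⋀-⊩ φs = mk⇔
    (λ h → by-contradiction λ n → h (from (imps-⊩ φs ⊥ᵖ) λ hs → ⊥-elim (n hs)))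
    (λ hs k → to (imps-⊩ φs ⊥ᵖ) k hs)

  ⋀-∈ : (q : GlobalType 𝕄 Γ) → ∀ {φs} → All ⟦ q ⟧ φs → ⋀ᵖ φs ∈ ⟦ q ⟧
  ⋀-∈ q {φs} hs = entails q φs (⋀ᵖ φs) hs λ e → from (⋀-⊩ φs)

  -- The type of `g` over `B` is finitely satisfiable in M by `reflect`, so the saturation of M
  -- realizes it.
  pullback : Small B → (g : Env N Γ) → Σ (Env M Γ) λ g* → ∀ χ → Over B χ → g ⊩ᴺ χ → g* ⊩ χ
  pullback {B = B} {Γ = Γ} B-small g = proj₁ realized , λ χ o h → proj₂ realized {χ} ((λ r → o r) , h)
    where
    Φ : FormulaSet M Γ
    Φ χ = Over B χ × g ⊩ᴺ χ
    realized : ∃[ e ] e ⊩* Φ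
    realized = saturated B-small Φ proj₁ λ φs hs → reflect φs g (All.map proj₂ hs)

  base-small : MonsterModel.Small monster base
  base-small = Element M , |M|<κ , (λ (t , m) → t , ι m) , λ { {t , _} (m , eq) → (t , m) , cong (t ,_) eq }

  Over-base : (φ : PFormula M Γ) → Over base (ι-formula φ)
  Over-base φ (v , eq) = All.lookup (parameters φ) v , trans (sym (lookup-map (parameters φ) v)) eq

  -- Compactness for arbitrary families over M, available because the whole of M is small for the
  -- larger monster.
  realizeᴺ : (P : Pred (PFormula M Γ) ℓ) →
    (∀ φs → All P φs → Σ (Env N Γ) λ g → All (g ⊩ᴺ_) φs) →
    Σ (Env N Γ) λ g → ∀ χ → χ ∈ P → g ⊩ᴺ χ
  realizeᴺ {Γ = Γ} P h = proj₁ realized , λ χ χ∈P → proj₂ realized (χ , χ∈P , refl)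
    where
    Φ : FormulaSet N Γ
    Φ ψ = ∃[ χ ] χ ∈ P × ψ ≡ ι-formula χ
    preimages : ∀ ψs → All Φ ψs → ∃[ φs ] All P φs × (∀ (g : Env N Γ) → All (g ⊩ᴺ_) φs → All (g ⊩_) ψs)
    preimages []       []                      = [] , [] , λ _ _ → []
    preimages (ψ ∷ ψs) ((χ , χ∈P , refl) ∷ hs) =
      let φs , φs∈P , k = preimages ψs hs in
      χ ∷ φs , χ∈P ∷ φs∈P , λ { g (x ∷ xs) → x ∷ k g xs }
    realized : ∃[ e ] e ⊩* Φ
    realized = MonsterModel.saturated monster base-small Φ (λ { (χ , _ , refl) → Over-base χ })
      λ ψs hs → let φs , φs∈P , k = preimages ψs hs
                    g , x = h φs φs∈P in g , k g x

  module _ {X : Context L} (p : GlobalType 𝕄 Γ) (q : GlobalType 𝕄 Δ)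
    (ρp : Renaming Γ X) (ρq : Renaming Δ X) (E : Pred (PFormula M X) ℓ) where

    Satisfies : PFormula M Γ → PFormula M Δ → Env N X → Set ℓ
    Satisfies δ ζ g = (g ⊩ᴺ renᵖ ρp δ) × (g ⊩ᴺ renᵖ ρq ζ) × (∀ ψ → ψ ∈ E → g ⊩ᴺ ψ)

    -- Global types are closed under conjunction, so a single formula from each stands for any
    -- finite part; `E` may lack this closure and is demanded in full at every stage.
    realize-jointly : (∀ δ ζ → δ ∈ ⟦ p ⟧ → ζ ∈ ⟦ q ⟧ → ∃ (Satisfies δ ζ)) →
      Σ (Env N X) λ g → (∀ δ → δ ∈ ⟦ p ⟧ → g ⊩ᴺ renᵖ ρp δ) × (∀ ζ → ζ ∈ ⟦ q ⟧ → g ⊩ᴺ renᵖ ρq ζ) ×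
        (∀ ψ → ψ ∈ E → g ⊩ᴺ ψ)
    realize-jointly h = g , (λ δ δ∈p → k (renᵖ ρp δ) (inj₁ (δ , δ∈p , refl))) ,
      (λ ζ ζ∈q → k (renᵖ ρq ζ) (inj₂ (inj₁ (ζ , ζ∈q , refl)))) , λ ψ ψ∈E → k ψ (inj₂ (inj₂ ψ∈E))
      where
      P : Pred (PFormula M X) ℓ
      P ψ = (∃[ δ ] δ ∈ ⟦ p ⟧ × ψ ≡ renᵖ ρp δ) ⊎ (∃[ ζ ] ζ ∈ ⟦ q ⟧ × ψ ≡ renᵖ ρq ζ) ⊎ ψ ∈ E

      ren-∧ˡ : ∀ {Γ} (ρ : Renaming Γ X) (δ δ′ : PFormula M Γ) {g} →
        g ⊩ᴺ renᵖ ρ (δ ∧ᵖ δ′) → (g ⊩ᴺ renᵖ ρ δ) × (g ⊩ᴺ renᵖ ρ δ′)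
      ren-∧ˡ ρ δ δ′ {g} x = from (ren-⊩ᴺ ρ δ A) (proj₁ y) , from (ren-⊩ᴺ ρ δ′ A) (proj₂ y)
        where
        A = lookup-restrict ρ g
        y = to (∧-⊩ᴺ δ δ′) (to (ren-⊩ᴺ ρ (δ ∧ᵖ δ′) A) x)

      Implied : List (PFormula M X) → Set ℓ
      Implied φs = ∃[ δ ] ∃[ ζ ] δ ∈ ⟦ p ⟧ × ζ ∈ ⟦ q ⟧ × (∀ g → Satisfies δ ζ g → All (g ⊩ᴺ_) φs)

      implied : ∀ φs → All P φs → Implied φs
      implied []       []       =
        ⊤ᵖ , ⊤ᵖ , entails p [] ⊤ᵖ [] (λ _ _ x → x) , entails q [] ⊤ᵖ [] (λ _ _ x → x) , λ _ _ → []
      implied (φ ∷ φs) (inj₁ (δ′ , δ′∈p , refl) ∷ hs) =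
        let δ , ζ , δ∈p , ζ∈q , k = implied φs hs in
        δ′ ∧ᵖ δ , ζ , ∧-∈ p δ′∈p δ∈p , ζ∈q , λ g (x , y , z) →
          let x₁ , x₂ = ren-∧ˡ ρp δ′ δ x in x₁ ∷ k g (x₂ , y , z)
      implied (φ ∷ φs) (inj₂ (inj₁ (ζ′ , ζ′∈q , refl)) ∷ hs) =
        let δ , ζ , δ∈p , ζ∈q , k = implied φs hs in
        δ , ζ′ ∧ᵖ ζ , δ∈p , ∧-∈ q ζ′∈q ζ∈q , λ g (x , y , z) →
          let y₁ , y₂ = ren-∧ˡ ρq ζ′ ζ y in y₁ ∷ k g (x , y₂ , z)
      implied (φ ∷ φs) (inj₂ (inj₂ φ∈E) ∷ hs) =
        let δ , ζ , δ∈p , ζ∈q , k = implied φs hs in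
        δ , ζ , δ∈p , ζ∈q , λ g (x , y , z) → z φ φ∈E ∷ k g (x , y , z)

      realized : Σ (Env N X) λ g → ∀ χ → χ ∈ P → g ⊩ᴺ χ
      realized = realizeᴺ P λ φs hs →
        let δ , ζ , δ∈p , ζ∈q , k = implied φs hs
            g , x = h δ ζ δ∈p ζ∈q in g , k g x

      g : Env N X
      g = proj₁ realized
      k : ∀ χ → χ ∈ P → g ⊩ᴺ χ
      k = proj₂ realized

  -- `Sem` asks for every formula of N over the image of M that holds at `a`. Each is rewritten as a
  -- formula over M, which is in `q` because `a` realizes `q`.
  semi-isolated⁺ : (q : GlobalType 𝕄 Γ) (a : Env N Γ) (b : Env N Δ) (θ : PFormula M (Γ ++ Δ)) →
    Realizes 𝕄⁺ a q → ++⁺ a b ⊩ᴺ θ → (∀ e → ++⁺ e b ⊩ᴺ θ → Realizes 𝕄⁺ e q) → a ∈ Sem N base b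
  semi-isolated⁺ {Γ = Γ} q a b θ a⊨q θab θ⊢q =
    Θ′ , (Θ′-over , from (∙-⊩ (ι-formula θ) b) θab) , λ {ψ} (o , h) →
      Θ′ ∷ [] , refl ∷ [] , λ { e (k ∷ []) → ψ-holds ψ (λ r → o r) h e (to (∙-⊩ (ι-formula θ) b) k) }
    where
    Θ′ : PFormula N Γ
    Θ′ = ι-formula θ ∙ b
    Θ′-over : Over (base ∪ Range N b) Θ′
    Θ′-over = Over-∙ {K = N} {B = base ∪ Range N b} (ι-formula θ) b (λ r → inj₁ (Over-base θ r)) inj₂
    ψ-holds : ∀ ψ → Over base ψ → a ⊩ ψ → ∀ e → ++⁺ e b ⊩ᴺ θ → e ⊩ ψ
    ψ-holds ψ o h e k = from (ξ⇔ψ e) (from (unit e) (θ⊢q e k ξ∈q))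
      where
      -- All parameters come from M, so the tuple turned into variables is empty; `drop-[]` removes
      -- the empty context left behind.
      NF = normal-form ι (λ _ → ⊤) [] ψ λ r → let m , eq = o r in inj₁ (m , tt , eq)
      ξ : PFormula M (Γ ++ [])
      ξ = proj₁ NF
      ξ⇔ψ : ∀ e → (e ⊩ ψ) ⇔ (++⁺ e [] ⊩ᴺ ξ)
      ξ⇔ψ = proj₂ (proj₂ NF)
      nothing : Renaming [] Γ
      nothing ()
      drop-[] : Renaming (Γ ++ []) Γ
      drop-[] = copair id nothing
      unit-along : ∀ e → Along drop-[] e (++⁺ e [])
      unit-along e = lookup-copair {f = id} {g = nothing} {e} {e} {[]} (along λ _ → refl) (along λ ())
      ξ′ : PFormula M Γ
      ξ′ = renᵖ drop-[] ξ
      unit : ∀ e → (++⁺ e [] ⊩ᴺ ξ) ⇔ (e ⊩ᴺ ξ′)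
      unit e = mk⇔ (from r) (to r)
        where
        r : (e ⊩ᴺ ξ′) ⇔ (++⁺ e [] ⊩ᴺ ξ)
        r = ren-⊩ᴺ drop-[] ξ {e} {++⁺ e []} (unit-along e)
      ξ∈q : ξ′ ∈ ⟦ q ⟧
      ξ∈q = [ id , (λ n → ⊥ₚ-elim {Whatever = λ _ → ξ′ ∈ ⟦ q ⟧} (a⊨q n (to (unit a) (to (ξ⇔ψ a) h)))) ]′ (complete q ξ′)

  semi-isolated⁻ : (q : GlobalType 𝕄 Γ) (a : Env N Γ) (b : Env N Δ) →
    Realizes 𝕄⁺ a q → a ∈ Sem N base b →
    Σ (PFormula M (Γ ++ Δ)) λ θ → (++⁺ a b ⊩ᴺ θ) × (∀ e → ++⁺ e b ⊩ᴺ θ → Realizes 𝕄⁺ e q)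
  semi-isolated⁻ q a b a⊨q (Θ′ , (o , h) , ent) =
    θ , to (θ⇔Θ′ a) h , λ e k {φ} φ∈q →
      let φs , φs≡ , imp = ent {ι-formula φ} ((λ r → Over-base φ r) , a⊨q φ∈q)
      in imp e (All.map (λ { refl → from (θ⇔Θ′ e) k }) φs≡)
    where
    NF = normal-form ι (λ _ → ⊤) b Θ′ λ r → [ (λ (m , eq) → inj₁ (m , tt , eq)) , inj₂ ]′ (o r)
    θ = proj₁ NF
    θ⇔Θ′ : ∀ e → (e ⊩ Θ′) ⇔ (++⁺ e b ⊩ᴺ θ)
    θ⇔Θ′ = proj₂ (proj₂ NF)

  -- Merging the premises from each type into one conjunction turns the entailment into the validity
  -- of one implication, which passes to N.
  jointly-entails-transfer : (p : GlobalType 𝕄 Γ) (q : GlobalType 𝕄 Δ) (θ : PFormula M (Γ ++ Δ)) →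
    JointlyEntails p q θ → ∃[ δ ] ∃[ ζ ] δ ∈ ⟦ p ⟧ × ζ ∈ ⟦ q ⟧ ×
      (∀ (a : Env N Γ) (b : Env N Δ) → a ⊩ᴺ δ → b ⊩ᴺ ζ → ++⁺ a b ⊩ᴺ θ)
  jointly-entails-transfer {Γ = Γ} {Δ = Δ} p q θ (φs , ψs , φs∈p , ψs∈q , ent) =
    ⋀ᵖ φs , ⋀ᵖ ψs , ⋀-∈ p φs∈p , ⋀-∈ q ψs∈q , λ a b x y →
      to (⇒-⊩ᴺ ψ θ) (to (⇒-⊩ᴺ φ (ψ ⇒ᵖ θ)) (transfer (φ ⇒ᵖ ψ ⇒ᵖ θ) valid (++⁺ a b))
        (from (ren-⊩ᴺ ∈-++⁺ˡ (⋀ᵖ φs) (lookup-++ˡ a b)) x))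
        (from (ren-⊩ᴺ (∈-++⁺ʳ Γ) (⋀ᵖ ψs) (lookup-++ʳ a b)) y)
    where
    φ ψ : PFormula M (Γ ++ Δ)
    φ = renᵖ ∈-++⁺ˡ (⋀ᵖ φs)
    ψ = renᵖ (∈-++⁺ʳ Γ) (⋀ᵖ ψs)
    valid : ∀ e → e ⊩ (φ ⇒ᵖ ψ ⇒ᵖ θ)
    valid e with ++-split Γ e
    ... | a , b , refl = from (⇒-⊩ φ (ψ ⇒ᵖ θ)) λ x → from (⇒-⊩ ψ θ) λ y →
          ent a b (to (⋀-⊩ φs) (to (⊩-ren ∈-++⁺ˡ (⋀ᵖ φs) (lookup-++ˡ a b)) x))
                  (to (⋀-⊩ ψs) (to (⊩-ren (∈-++⁺ʳ Γ) (⋀ᵖ ψs) (lookup-++ʳ a b)) y))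

  -- The image of `e` in N realizes `q`, so by elementarity `e` realizes `q` inside M.
  isolated⇒algebraic : (q : GlobalType 𝕄 Γ) (θ : PFormula M Γ) → ∀ e → e ⊩ θ →
    (∀ g → g ⊩ᴺ θ → Realizes 𝕄⁺ g q) → ¬ NonAlgebraic q
  isolated⇒algebraic q θ e θe θ⊢q = realized⇒algebraic q e λ {φ} φ∈q →
    from (ι-⊩ φ e) (θ⊢q (All.map ι e) (to (ι-⊩ θ e) θe) φ∈q)

-- Subsequences and the pigeonhole principle

module _ {a} {A : Set a} where

  infix 4 _⊴_

  data _⊴_ : ∀ {m n} → Vec A m → Vec A n → Set a where
    []   : [] ⊴ []
    keep : ∀ {m n x} {xs : Vec A m} {ys : Vec A n} → xs ⊴ ys → (x ∷ xs) ⊴ (x ∷ ys)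
    skip : ∀ {m n y} {xs : Vec A m} {ys : Vec A n} → xs ⊴ ys → xs ⊴ (y ∷ ys)

  []⊴ : ∀ {n} (ys : Vec A n) → [] ⊴ ys
  []⊴ []       = []
  []⊴ (y ∷ ys) = skip ([]⊴ ys)

  AllOf : ∀ {b} (P : A → Set b) {n} → Vec A n → Set b
  AllOf P xs = ∀ i → P (lookup xs i)

  pigeonhole : ∀ {b} → ExcludedMiddle b → (P : A → Set b) → ∀ m n {k} (ys : Vec A k) → k ≡ m + n →
    (Σ (Vec A m) λ xs → xs ⊴ ys × AllOf P xs) ⊎ (Σ (Vec A n) λ xs → xs ⊴ ys × AllOf (¬_ ∘ P) xs)
  pigeonhole em P zero    n ys eq = inj₁ ([] , []⊴ ys , λ ())
  pigeonhole em P (suc m) n (y ∷ ys) eq with em {P y}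
  ... | yes py with pigeonhole em P m n ys (suc-injective eq)
  ...   | inj₁ (xs , h , k) = inj₁ (y ∷ xs , keep h , λ { zero → py ; (suc i) → k i })
  ...   | inj₂ (xs , h , k) = inj₂ (xs , skip h , k)
  pigeonhole em P (suc m) zero    (y ∷ ys) eq | no ¬py = inj₂ ([] , []⊴ (y ∷ ys) , λ ())
  pigeonhole em P (suc m) (suc n) (y ∷ ys) eq | no ¬py
    with pigeonhole em P (suc m) n ys (trans (suc-injective eq) (+-suc m n))
  ... | inj₁ (xs , h , k) = inj₁ (xs , skip h , k)
  ... | inj₂ (xs , h , k) = inj₂ (y ∷ xs , keep h , λ { zero → ¬py ; (suc i) → k i })

-- Generic stability: a bound on false-then-true patterns

module Stable {ℓ} (em : ∀ ℓ′ → ExcludedMiddle ℓ′) {L : Language ℓ} {T : Theory L} (𝕄 : MonsterModel T)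
  (𝕄⁺ : LargerMonster 𝕄) {s} (p : GlobalType 𝕄 (s ∷ [])) where
  open Language L using (Sort)
  open MonsterModel 𝕄 renaming (structure to M)
  open Classical {L = L} em
  open Monster em 𝕄
  open Morley p
  open LargerMonster 𝕄⁺ using (N; ι; base; embedding; ι-formula)
  open Extension em embedding
  open Larger em 𝕄 𝕄⁺

  private
    variable
      Γ Θ : Context L
      t : Sort
      B C C′ : ParameterSet M

    x₀ : Element M
    x₀ = s , Structure.nonempty M s

  module Stability {A} (A-small : Small A) (A-inv : InvariantOver A p)
    (stable : ∀ {I : Set ℓ} {_<_ : I → I → Set ℓ} →
         IsStrictTotalOrder _≡_ _<_ → WellFounded _<_ → Infinite I →
         (a : I → Env M (s ∷ [])) → MorleySequence _<_ p A a →
         (φ : PFormula M (s ∷ [])) →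
         Finite (λ i → a i ⊩ φ) ⊎ Cofinite (λ i → a i ⊩ φ)) where

    -- The concatenation of `u` and `v` is a Morley sequence over `A` of type ω + ω on which `φ`
    -- holds at exactly the second half.
    no-ω+ω-pattern : ∀ u v → (∀ i → u i ⊨↾ A ∪ Before u i) → (∀ i → v i ⊨↾ (A ∪ Image u) ∪ Before v i) →
      ∀ φ → (∀ i → ¬ ((u i ∷ []) ⊩ φ)) → (∀ i → (v i ∷ []) ⊩ φ) → ⊥ₚ {ℓ}
    no-ω+ω-pattern u v hu hv φ ¬φu φv
      with stable <ω-isStrictTotalOrder <ω-wellFounded infinite a a-morley φ
      where
      infinite : Infinite (ω+ω ℓ)
      infinite (xs , h) = let k , b = ω-bounded xs in proj₁ (b k ≤-refl) (h _)
      a : ω+ω ℓ → Env M (s ∷ [])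
      a (fst i) = u i ∷ []
      a (snd i) = v i ∷ []
      a-morley : MorleySequence _<ω_ p A a
      a-morley (fst i) = ⊨↾-antitone
        (λ { (inj₁ x) → inj₁ x
           ; (inj₂ (_ , fst<fst {j} j<i , (here refl , refl))) → inj₂ (j , j<i , refl) }) (hu i)
      a-morley (snd i) = ⊨↾-antitone
        (λ { (inj₁ x) → inj₁ (inj₁ x)
           ; (inj₂ (_ , fst<snd {j} , (here refl , refl))) → inj₁ (inj₂ (j , refl))
           ; (inj₂ (_ , snd<snd {j} j<i , (here refl , refl))) → inj₂ (j , j<i , refl) }) (hv i)
    ... | inj₁ (xs , h) = let k , b = ω-bounded xs in ⊥-elim (proj₂ (b k ≤-refl) (h (φv k)))
    ... | inj₂ (xs , h) = let k , b = ω-bounded xs in ⊥-elim (proj₁ (b k ≤-refl) (h (¬φu k)))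

    -- As C contains A and xs, together xs and ys form a Morley sequence of length 2n over A.
    NoPattern : PFormula M (s ∷ Θ) → ℕ → Set (Level.suc ℓ)
    NoPattern χ n = ∀ (xs ys : Vec (Carrier M s) n) c {C} →
      A ⊆ C → (∀ i → (s , lookup xs i) ∈ C) → Mor A xs → Mor C ys →
      (∀ i → ¬ (lookup xs i ∷ c ⊩ χ)) → (∀ i → lookup ys i ∷ c ⊩ χ) → ⊥ₚ {ℓ}

    record Pattern (χ : PFormula M (s ∷ Θ)) (n : ℕ) : Set (Level.suc ℓ) where
      field
        xs ys   : Vec (Carrier M s) n
        c       : Env M Θ
        D       : ParameterSet M
        A⊆D     : A ⊆ D
        xs⊆D    : ∀ i → (s , lookup xs i) ∈ D
        xs-Mor  : Mor A xs
        ys-Mor  : Mor D ys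
        ¬χxs    : ∀ i → ¬ (lookup xs i ∷ c ⊩ χ)
        χys     : ∀ i → lookup ys i ∷ c ⊩ χ

    module Compactness (χ : PFormula M (s ∷ Θ)) (χ-over : Over A χ) where

      module _ (pattern-n : ∀ n → Pattern χ n)
        {u v} (hu : ∀ i → u i ⊨↾ A ∪ Before u i) (hv : ∀ i → v i ⊨↾ (A ∪ Image u) ∪ Before v i) where

        Φ : FormulaSet M Θ
        Φ ψ = ∃[ i ] (ψ ≡ atᵖ (u i) (¬ᵖ χ) ⊎ ψ ≡ atᵖ (v i) χ)

        bound : ∀ φs → All Φ φs → ∃[ n ] All (λ ψ → ∃[ i ] i < n × (ψ ≡ atᵖ (u i) (¬ᵖ χ) ⊎ ψ ≡ atᵖ (v i) χ)) φs
        bound []       []              = 0 , []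
        bound (φ ∷ φs) ((i , h) ∷ hs) with bound φs hs
        ... | n , k = suc i ⊔ᴺ n , (i , ℕ.m≤m⊔n (suc i) n , h) ∷
                All.map (λ (j , j<n , h) → j , ≤-trans j<n (ℕ.m≤n⊔m (suc i) n) , h) k

        module _ (n : ℕ) where
          open Pattern (pattern-n n)

          us vs : Vec (Carrier M s) n
          us = segment u 0 n
          vs = segment v 0 n

          X : Context L
          X = rep s n (rep s n [])

          e e′ : Env M X
          e  = ys ⊕ xs ⊕ []
          e′ = vs ⊕ us ⊕ []

          e≡e′ : Same A e e′
          -- The first halves are compared over `A`, and then the second halves over `D` and
          -- `A ∪ Image u`, which contain the respective first halves.
          e≡e′ = tp-⊕ A-inv {C = D} {C′ = A ∪ Image u} (xs ⊕ []) (us ⊕ []) ys vs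
            A⊆D (Range-⊕⁻ {K = M} xs [] {D} (λ { (() , _) }) xs⊆D)
            inj₁ (Range-⊕⁻ {K = M} us [] {A ∪ Image u} (λ { (() , _) }) (λ i → inj₂ (toℕ i , cong (s ,_) (sym (lookup-segment u 0 n i)))))
            (tp-⊕ A-inv {C = A} {C′ = A} [] [] xs us id (λ { (() , _) }) id (λ { (() , _) })
              (λ _ _ → ⇔-id _) xs-Mor (segment₀-Mor hu n))
            ys-Mor (segment₀-Mor hv n)

          -- `Φ` has parameters in `u` and `v`, while types agree over `A` only. So `F` is over `A`
          -- and has the terms of the sequences as variables: it is read at `e` as a fact about the
          -- pattern, and at `e′` as a condition on `u` and `v`.
          Witness : PFormula M Θ → Set ℓ
          Witness ψ = Σ (PFormula M (Θ ++ X)) λ F → (∀ m → m ∈ Range M (parameters F) → m ∈ A) ×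
            (++⁺ c e ⊩ F) × (∀ c′ → ++⁺ c′ e′ ⊩ F → c′ ⊩ ψ)

          selected : (w : s ∈ˡ X) {θ : PFormula M (s ∷ Θ)} → Over A θ → (m : Carrier M s) →
            (All.lookup e w ∷ c ⊩ θ) → All.lookup e′ w ≡ m → Witness (atᵖ m θ)
          selected w {θ} o m h refl = renᵖ (select w) θ , (λ _ r → o r) ,
            from (⊩-ren (select w) θ (lookup-select c e w)) h ,
            λ c′ k → from (at-⊩ m θ) (to (⊩-ren (select w) θ (lookup-select c′ e′ w)) k)

          lookup-fromℕ< : ∀ (w : ℕ → Carrier M s) {i} (i<n : i < n) → lookup (segment w 0 n) (fromℕ< i<n) ≡ w i
          lookup-fromℕ< w i<n = trans (lookup-segment w 0 n _) (cong w (toℕ-fromℕ< i<n))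

          lookup-inner : ∀ (zs ws : Vec (Carrier M s) n) j →
            All.lookup {P = Carrier M} (ws ⊕ zs ⊕ []) (weaken n (position j)) ≡ lookup zs j
          lookup-inner zs ws j =
            trans (lookup-weaken {P = Carrier M} ws (zs ⊕ []) .at (position j)) (lookup-position {P = Carrier M} zs [] j)

          lookup-outer : ∀ (zs ws : Vec (Carrier M s) n) j →
            All.lookup {P = Carrier M} (ws ⊕ zs ⊕ []) (position j) ≡ lookup ws j
          lookup-outer zs ws j = lookup-position {P = Carrier M} ws (zs ⊕ []) j

          witness : ∀ {ψ} → ∃[ i ] i < n × (ψ ≡ atᵖ (u i) (¬ᵖ χ) ⊎ ψ ≡ atᵖ (v i) χ) → Witness ψ
          witness (i , i<n , inj₁ refl) = selected (weaken n (position (fromℕ< i<n))) {¬ᵖ χ} χ-over (u i)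
            (λ h → ⊥-elim (¬χxs j (subst (λ m → m ∷ c ⊩ χ) (lookup-inner xs ys j) h)))
            (trans (lookup-inner us vs j) (lookup-fromℕ< u i<n))
            where
            j : Fin n
            j = fromℕ< i<n
          witness (i , i<n , inj₂ refl) = selected (position (fromℕ< i<n)) {χ} χ-over (v i)
            (subst (λ m → m ∷ c ⊩ χ) (sym (lookup-outer xs ys j)) (χys j))
            (trans (lookup-outer us vs j) (lookup-fromℕ< v i<n))
            where
            j : Fin n
            j = fromℕ< i<n

          collect : ∀ φs → All Witness φs → Σ (List (PFormula M (Θ ++ X))) λ Fs →
            (∀ m → m ∈ Range M (parameters (impsᵖ Fs ⊥ᵖ)) → m ∈ A) × All (++⁺ c e ⊩_) Fs ×
            (∀ c′ → All (++⁺ c′ e′ ⊩_) Fs → All (c′ ⊩_) φs)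
          collect []       []                     = [] , (λ { _ (() , _) }) , [] , λ _ _ → []
          collect (φ ∷ φs) ((F , o , h , k) ∷ ws) with collect φs ws
          ... | Fs , os , hs , ks = F ∷ Fs ,
                (λ _ r → Over-⇒ F (impsᵖ Fs ⊥ᵖ) (λ r → o _ r) (λ r → os _ r) r) , h ∷ hs ,
                λ { c′ (x ∷ xs) → k c′ x ∷ ks c′ xs }

          -- That some tuple satisfies all `Fs` is a formula over `A`. It holds at `e`, witnessed by
          -- `c`, hence at `e′`.
          satisfiable : ∀ φs → All Witness φs → ∃[ c′ ] All (c′ ⊩_) φs
          satisfiable φs ws with collect φs ws
          ... | Fs , o , h , k
              with to (∃*-⊩ Θ (¬ᵖ impsᵖ Fs ⊥ᵖ)) (to (e≡e′ (∃*ᵖ Θ (¬ᵖ impsᵖ Fs ⊥ᵖ))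
                     (λ _ r → Over-∀* Θ (¬ᵖ ¬ᵖ impsᵖ Fs ⊥ᵖ) (λ r → o _ r) r))
                   (from (∃*-⊩ Θ (¬ᵖ impsᵖ Fs ⊥ᵖ)) (c , λ n → to (imps-⊩ Fs ⊥ᵖ) n h)))
          ... | c′ , k′ = c′ , by-contradiction λ n → k′ (from (imps-⊩ Fs ⊥ᵖ) λ hs → ⊥-elim (n (k c′ hs)))

        Φ-satisfiable : FinitelySatisfiable Φ
        Φ-satisfiable φs h = let n , k = bound φs h in satisfiable n φs (All.map (witness n) k)

        Parameters : ParameterSet M
        Parameters = (A ∪ Image u) ∪ Image v

        Φ-over : Φ ⊆ Over Parameters
        Φ-over (i , inj₁ refl) r =
          Over-at {B = Parameters} (u i) (¬ᵖ χ) (inj₁ (inj₂ (i , refl))) (λ r → inj₁ (inj₁ (χ-over r))) r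
        Φ-over (i , inj₂ refl) r =
          Over-at {B = Parameters} (v i) χ (inj₂ (i , refl)) (λ r → inj₁ (inj₁ (χ-over r))) r

        -- By saturation some c̄ realizes `Φ`: χ(-, c̄) is false on all of `u` and true on all of
        -- `v`, a pattern of type ω + ω.
        absurd : ⊥ₚ {ℓ}
        absurd with saturated (small-∪ (small-∪ A-small (Image-countable u)) (Image-countable v)) Φ
                      (λ {ψ} h {m} r → Φ-over {ψ} h {m} r) Φ-satisfiable
        ... | c , h = no-ω+ω-pattern u v hu hv (χ ∙ᵗ c)
              (λ i x → ⊥ₚ-elim (to (at-⊩ (u i) (¬ᵖ χ)) (h (i , inj₁ refl)) x))
              (λ i → to (at-⊩ (v i) χ) (h (i , inj₂ refl)))

      find-pattern : ∀ n → ¬ NoPattern χ n → Pattern χ n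
      find-pattern n ¬np with em _ {Pattern χ n}
      ... | yes P = P
      ... | no ∄P = ⊥-elim (¬np np)
        where
        np : NoPattern χ n
        np xs ys c {C} A⊆C xs⊆C xs-Mor ys-Mor ¬χxs χys = ⊥-elim (∄P (record
          { xs = xs ; ys = ys ; c = c ; D = C ; A⊆D = A⊆C ; xs⊆D = xs⊆C
          ; xs-Mor = xs-Mor ; ys-Mor = ys-Mor ; ¬χxs = ¬χxs ; χys = χys }))

      no-pattern : ∃[ n ] NoPattern χ n
      no-pattern = by-contradiction λ ∄n →
        let u , hu = infinite-Mor A-small
            v , hv = infinite-Mor (small-∪ A-small (Image-countable u))
        in absurd (λ n → find-pattern n (λ np → ∄n (n , np))) hu hv

    abstract
      -- The parameters of `χ` may lie outside `A`. Read as further variables they leave a formula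
      -- without parameters, to which compactness applies.
      no-pattern : (χ : PFormula M (s ∷ Γ)) → ∃[ n ] NoPattern χ n
      no-pattern χ@(φ ⟨ d ⟩) = proj₁ pure , generalize
        where
        pure : ∃[ n ] NoPattern (pureᵖ φ) n
        pure = Compactness.no-pattern (pureᵖ φ) (λ { (() , _) })
        generalize : NoPattern χ (proj₁ pure)
        generalize xs ys c {C} A⊆C xs⊆C xs-Mor ys-Mor ¬χxs χys =
          proj₂ pure xs ys (++⁺ c d) {C} A⊆C xs⊆C xs-Mor ys-Mor
            (λ i x → ¬χxs i (to (pure-⊩ {K = M} φ {lookup xs i ∷ ++⁺ c d}) x))
            (λ i → from (pure-⊩ {K = M} φ {lookup ys i ∷ ++⁺ c d}) (χys i))

    ⊴-Mor : ∀ {m n} {xs : Vec (Carrier M s) m} {ys : Vec (Carrier M s) n} → xs ⊴ ys → Mor C ys → Mor C xs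
    ⊴-Mor []       _        = tt
    ⊴-Mor (keep h) (y , ys) = y , ⊴-Mor h ys
    ⊴-Mor {xs = xs} (skip h) (y , ys) = ⊴-Mor h (Mor-antitone _ inj₁ ys)

    -- Otherwise `xs`, followed by a Morley sequence over `A`, `xs`, `c` and the parameters of `χ`,
    -- would be a forbidden pattern.
    not-all : ∀ {n} {χ : PFormula M (s ∷ Γ)} → NoPattern χ n → (xs : Vec (Carrier M s) n) → Mor A xs →
      ∀ c → (∀ i → ¬ (lookup xs i ∷ c ⊩ χ)) → ¬ ((χ ∙ᵗ c) ∈ ⟦ p ⟧)
    not-all {n = n} {χ} np xs xs-Mor c ¬χxs χc∈p = ⊥ₚ-elim (np xs ys c {D}
        (λ x → inj₁ (inj₁ x))
        (λ i → inj₁ (inj₂ (position i , lookup-position {P = Carrier M} xs [] i)))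
        xs-Mor ys-Mor ¬χxs (λ i → Mor-⊨↾ ys ys-Mor i {χ ∙ᵗ c} (χc∈p , inj₂)))
      where
      D : ParameterSet M
      D = (A ∪ Range M (xs ⊕ [])) ∪ Range M (++⁺ c (parameters χ))
      V : Σ (ℕ → Carrier M s) λ v → ∀ i → v i ⊨↾ D ∪ Before v i
      V = infinite-Mor (small-∪ (small-∪ A-small (Range-countable x₀ (xs ⊕ [])))
                         (Range-countable x₀ (++⁺ c (parameters χ))))
      ys : Vec (Carrier M s) n
      ys = segment (proj₁ V) 0 n
      ys-Mor : Mor D ys
      ys-Mor = segment₀-Mor (proj₂ V) n

    -- Definability of p by counting along one Morley sequence

    abstract
      u : ℕ → Carrier M s
      u = proj₁ (infinite-Mor A-small)

      u-Mor : ∀ i → u i ⊨↾ A ∪ Before u i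
      u-Mor = proj₂ (infinite-Mor A-small)

    module _ (χ : PFormula M (s ∷ Γ)) where

      -- The counting formula "at least `n` terms m of the vector satisfy χ(m, ȳ)", with α ∨ β
      -- spelled as ¬ α ⇒ β.
      threshold : ∀ {k} → ℕ → Vec (Carrier M s) k → PFormula M Γ
      threshold zero    ms       = ⊤ᵖ
      threshold (suc n) []       = ⊥ᵖ
      threshold (suc n) (m ∷ ms) = ¬ᵖ (atᵖ m χ ∧ᵖ threshold n ms) ⇒ᵖ threshold (suc n) ms

      threshold⁻ : ∀ {k} n (ms : Vec (Carrier M s) k) {c} → c ⊩ threshold n ms →
        Σ (Vec (Carrier M s) n) λ xs → xs ⊴ ms × (∀ i → lookup xs i ∷ c ⊩ χ)
      threshold⁻ zero    ms       h = [] , []⊴ ms , λ ()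
      threshold⁻ (suc n) []       ()
      threshold⁻ (suc n) (m ∷ ms) {c} h with em _ {c ⊩ (atᵖ m χ ∧ᵖ threshold n ms)}
      ... | yes k with to (∧-⊩ (atᵖ m χ) (threshold n ms)) k
      ...   | χm , t with threshold⁻ n ms t
      ...     | xs , xs⊴ms , χxs = m ∷ xs , keep xs⊴ms , λ { zero → to (at-⊩ m χ) χm ; (suc i) → χxs i }
      threshold⁻ (suc n) (m ∷ ms) h | no ¬k
        with threshold⁻ (suc n) ms (to (⇒-⊩ (¬ᵖ (atᵖ m χ ∧ᵖ threshold n ms)) (threshold (suc n) ms)) h
               (λ k → ⊥-elim (¬k k)))
      ... | xs , xs⊴ms , χxs = xs , skip xs⊴ms , χxs

      threshold⁺ : ∀ {k n} {ms : Vec (Carrier M s) k} {xs : Vec (Carrier M s) n} {c} → xs ⊴ ms →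
        (∀ i → lookup xs i ∷ c ⊩ χ) → c ⊩ threshold n ms
      threshold⁺ []       χxs = λ ()
      threshold⁺ {n = suc n} {m ∷ ms} (keep h) χxs =
        from (⇒-⊩ (¬ᵖ (atᵖ m χ ∧ᵖ threshold n ms)) (threshold (suc n) ms)) λ ¬k →
          ⊥ₚ-elim (¬k (from (∧-⊩ (atᵖ m χ) (threshold n ms))
            (from (at-⊩ m χ) (χxs zero) , threshold⁺ h (χxs ∘ suc))))
      threshold⁺ {n = zero}       (skip h) χxs = λ ()
      threshold⁺ {n = suc n} {m ∷ ms} (skip h) χxs =
        from (⇒-⊩ (¬ᵖ (atᵖ m χ ∧ᵖ threshold n ms)) (threshold (suc n) ms)) λ _ → threshold⁺ h χxs

      Over-threshold : Over B χ → ∀ {k} n (ms : Vec (Carrier M s) k) →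
        (∀ i → (s , lookup ms i) ∈ B) → Over B (threshold n ms)
      Over-threshold o zero    ms       h (() , _)
      Over-threshold o (suc n) []       h (() , _)
      Over-threshold {B = B} o (suc n) (m ∷ ms) h r =
        Over-⇒ {B = B} (¬ᵖ (atᵖ m χ ∧ᵖ threshold n ms)) (threshold (suc n) ms)
          (λ r → Over-∧ {B = B} (atᵖ m χ) (threshold n ms) (Over-at {B = B} m χ (h zero) o)
                   (Over-threshold o n ms (h ∘ suc)) r)
          (λ r → Over-threshold o (suc n) ms (h ∘ suc) r) r

    -- If ¬ χ(x, c̄) ∈ p then fewer than n terms of a Morley sequence satisfy χ(-, c̄), and if
    -- χ(x, c̄) ∈ p then fewer than n′ fail it; so n + n′ terms decide which case holds.
    abstract
      d : PFormula M (s ∷ Γ) → PFormula M Γ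
      d χ = threshold χ n (segment u 0 (n + proj₁ (no-pattern χ)))
        where
        n : ℕ
        n = proj₁ (no-pattern (¬ᵖ χ))

      d-⊩ : ∀ (χ : PFormula M (s ∷ Γ)) {c} → (c ⊩ d χ) ⇔ ((χ ∙ᵗ c) ∈ ⟦ p ⟧)
      d-⊩ χ {c} = mk⇔
        (λ h → [ id , (λ ¬χc∈p → ⊥-elim (few-¬χ ¬χc∈p (threshold⁻ χ n us h))) ]′ (complete p (χ ∙ᵗ c)))
        (λ χc∈p → [ (λ (xs , xs⊴us , χxs) → threshold⁺ χ xs⊴us χxs) ,
                     (λ h → ⊥-elim (few-χ χc∈p h)) ]′ (pigeonhole (em _) (λ x → x ∷ c ⊩ χ) n n′ us refl))
        where
        n n′ : ℕ
        n = proj₁ (no-pattern (¬ᵖ χ))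
        n′ = proj₁ (no-pattern χ)
        us : Vec (Carrier M s) (n + n′)
        us = segment u 0 (n + n′)
        us-Mor : Mor A us
        us-Mor = segment₀-Mor u-Mor (n + n′)
        few-¬χ : (¬ᵖ χ ∙ᵗ c) ∈ ⟦ p ⟧ →
          ¬ (Σ (Vec (Carrier M s) n) λ xs → xs ⊴ us × (∀ i → lookup xs i ∷ c ⊩ χ))
        few-¬χ ¬χc∈p (xs , xs⊴us , χxs) = not-all {χ = ¬ᵖ χ} (proj₂ (no-pattern (¬ᵖ χ))) xs
          (⊴-Mor xs⊴us us-Mor) c (λ i k → ⊥ₚ-elim (k (χxs i))) ¬χc∈p
        few-χ : (χ ∙ᵗ c) ∈ ⟦ p ⟧ →
          ¬ (Σ (Vec (Carrier M s) n′) λ xs → xs ⊴ us × (∀ i → ¬ (lookup xs i ∷ c ⊩ χ)))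
        few-χ χc∈p (xs , xs⊴us , ¬χxs) = not-all {χ = χ} (proj₂ (no-pattern χ)) xs
          (⊴-Mor xs⊴us us-Mor) c ¬χxs χc∈p

      Over-d : ∀ {B} (χ : PFormula M (s ∷ Γ)) → Over B χ → Image u ⊆ B → Over B (d χ)
      Over-d {B = B} χ o u⊆B r = Over-threshold χ {B = B} o (proj₁ (no-pattern (¬ᵖ χ))) (segment u 0 k)
        (λ i → u⊆B (toℕ i , cong (s ,_) (sym (lookup-segment u 0 k i)))) r
        where
        k : ℕ
        k = proj₁ (no-pattern (¬ᵖ χ)) + proj₁ (no-pattern χ)

    -- Symmetry of p ⊗ p

    swap : Renaming (s ∷ s ∷ []) (s ∷ s ∷ [])
    swap (here refl)         = there (here refl)
    swap (there (here refl)) = here refl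

    swap-⊩ : ∀ (ρ : PFormula M (s ∷ s ∷ [])) {x y} → (x ∷ y ∷ [] ⊩ renᵖ swap ρ) ⇔ (y ∷ x ∷ [] ⊩ ρ)
    swap-⊩ ρ = ⊩-ren swap ρ (along λ { (here refl) → refl ; (there (here refl)) → refl })

    -- If d ρ ∈ p but ¬ d ρˢ ∈ p, then ρ(-, c) ∈ p fails on a Morley sequence that c continues.
    module Symmetry (ρ : PFormula M (s ∷ s ∷ [])) where

      ρˢ : PFormula M (s ∷ s ∷ [])
      ρˢ = renᵖ swap ρ

      n : ℕ
      n = proj₁ (no-pattern ρ)

      D : ParameterSet M
      D = (A ∪ Image u) ∪ Range M (parameters ρ)

      D-small : Small D
      D-small = small-∪ (small-∪ A-small (Image-countable u)) (Range-countable x₀ (parameters ρ))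

      module _ (w : ℕ → Carrier M s) (w-Mor : ∀ i → w i ⊨↾ D ∪ Before w i) where

        xs : Vec (Carrier M s) n
        xs = segment w 0 n

        xs-Mor : Mor D xs
        xs-Mor = segment₀-Mor w-Mor n

        c : Carrier M s
        c = w n

        dρ-over : Over (D ∪ Before w n) (d ρ)
        dρ-over r = inj₁ (Over-d {B = D} ρ (λ r → inj₂ r) (λ r → inj₁ (inj₂ r)) r)

        ρc : d ρ ∈ ⟦ p ⟧ → (ρ ∙ᵗ (c ∷ [])) ∈ ⟦ p ⟧
        ρc dρ∈p = to (d-⊩ ρ {c ∷ []}) (w-Mor n {d ρ} (dρ∈p , dρ-over))

        module _ (¬dρˢ∈p : (¬ᵖ d ρˢ) ∈ ⟦ p ⟧) (i : Fin n) where

          x : Carrier M s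
          x = lookup xs i

          x∈Before : (s , x) ∈ Before w n
          x∈Before = toℕ i , toℕ<n i , cong (s ,_) (sym (lookup-segment w 0 n i))

          ¬dρˢ : (x ∷ []) ⊩ ¬ᵖ d ρˢ
          ¬dρˢ = Mor-⊨↾ xs xs-Mor i {¬ᵖ d ρˢ}
            (¬dρˢ∈p , λ r → Over-d {B = D} ρˢ (λ r → inj₂ r) (λ r → inj₁ (inj₂ r)) r)

          ¬ρˢx∈p : (¬ᵖ (ρˢ ∙ᵗ (x ∷ []))) ∈ ⟦ p ⟧
          ¬ρˢx∈p = ∉⇒¬∈ p (ρˢ ∙ᵗ (x ∷ [])) (λ k → ⊥ₚ-elim (¬dρˢ (from (d-⊩ ρˢ {x ∷ []}) k)))

          ρˢx-over : Over (D ∪ Before w n) (ρˢ ∙ᵗ (x ∷ []))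
          ρˢx-over r = Range-++ {K = M} (D ∪ Before w n) (x ∷ []) (parameters ρ)
            (λ { (here refl , refl) → inj₂ x∈Before }) (λ r → inj₁ (inj₂ r)) r

          -- `ρˢ`(-, x) is `ρ`(x, -). Its negation is in `p` because x satisfies ¬ `d ρˢ`, and `c`
          -- realizes `p` over x.
          ¬ρxs : ¬ (x ∷ c ∷ [] ⊩ ρ)
          ¬ρxs h = ⊥ₚ-elim (w-Mor n {¬ᵖ (ρˢ ∙ᵗ (x ∷ []))} (¬ρˢx∈p , ρˢx-over)
            (from (swap-⊩ ρ {c} {x}) h))

    d-symmetric : (ρ : PFormula M (s ∷ s ∷ [])) → d ρ ∈ ⟦ p ⟧ → d (renᵖ swap ρ) ∈ ⟦ p ⟧
    d-symmetric ρ dρ∈p = [ id , (λ y → ⊥-elim (contradiction (infinite-Mor D-small) y)) ]′ (complete p (d ρˢ))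
      where
      open Symmetry ρ
      contradiction : Σ (ℕ → Carrier M s) (λ w → ∀ i → w i ⊨↾ D ∪ Before w i) → ¬ ((¬ᵖ d ρˢ) ∈ ⟦ p ⟧)
      -- The segment has the length at which `ρ` admits no pattern, and `c` is the term right after
      -- it.
      contradiction (w , w-Mor) y = not-all {χ = ρ} (proj₂ (no-pattern ρ)) (xs w w-Mor)
        (Mor-antitone {C′ = D} (xs w w-Mor) (λ x → inj₁ (inj₁ x)) (xs-Mor w w-Mor)) (c w w-Mor ∷ [])
        (¬ρxs w w-Mor y) (ρc w w-Mor dρ∈p)

    -- Generic elements and generic sequences in N

    -- x realizes the extension of p to M f̄ given by its definition.
    Generic : Env N Γ → Carrier N s → Set ℓ
    Generic {Γ} f x = ∀ (χ : PFormula M (s ∷ Γ)) → f ⊩ᴺ d χ → x ∷ f ⊩ᴺ χ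

    generic-[] : ∀ {x} → Realizes 𝕄⁺ (x ∷ []) p → Generic [] x
    generic-[] x⊨p χ dχ = x⊨p (to (d-⊩ χ) (from (ι-⊩ (d χ) []) dχ))

    -- The parameters u of the definition of p lie in B, so d ξ ⇒ ξ is over B whenever ξ is.
    generic-pullback : Image u ⊆ B → ∀ {x f x*} (f* : Env M Γ) → Generic f x →
      (∀ (χ : PFormula M (s ∷ Γ)) → Over B χ → x ∷ f ⊩ᴺ χ → x* ∷ f* ⊩ χ) → x* ⊨↾ (B ∪ Range M f*)
    generic-pullback {B = B} {Γ = Γ} u⊆B {x} {f} {x*} f* gen tr {ψ} (ψ∈p , o) =
      from (ξ⇔ψ (x* ∷ [])) (to (⇒-⊩ (renᵖ there (d ξ)) ξ) dξ⇒ξ (from (⊩-ren there (d ξ) Along-there) dξ))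
      where
      NF : Σ (PFormula M (s ∷ Γ)) λ ξ → Over B ξ × (∀ e → (e ⊩ ψ) ⇔ (++⁺ e f* ⊩ mapᵖ {M = M} {K = M} id ξ))
      NF = normal-form {M = M} {K = M} id B f* ψ λ r → [ (λ b → inj₁ (_ , b , refl)) , inj₂ ]′ (o r)
      ξ : PFormula M (s ∷ Γ)
      ξ = proj₁ NF
      ξ-over : Over B ξ
      ξ-over = proj₁ (proj₂ NF)
      ξ⇔ψ : ∀ e → (e ⊩ ψ) ⇔ (++⁺ e f* ⊩ ξ)
      ξ⇔ψ e = subst (λ d → (e ⊩ ψ) ⇔ (++⁺ e f* ⊩ formula ξ ⟨ d ⟩)) (map-id (parameters ξ)) (proj₂ (proj₂ NF) e)
      dξ : f* ⊩ d ξ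
      dξ = from (d-⊩ ξ {f*}) (entails p (ψ ∷ []) (ξ ∙ᵗ f*) (ψ∈p ∷ []) λ { (y ∷ []) (h ∷ []) → to (ξ⇔ψ (y ∷ [])) h })
      -- In N this implication holds at (x, f̄) since x is generic over f̄; being over `B`, it is
      -- carried to M by `tr`.
      dξ⇒ξ : x* ∷ f* ⊩ (renᵖ there (d ξ) ⇒ᵖ ξ)
      dξ⇒ξ = tr (renᵖ there (d ξ) ⇒ᵖ ξ)
        (λ r → Over-⇒ {K = M} {B = B} (renᵖ there (d ξ)) ξ (λ r → Over-d {B = B} ξ ξ-over u⊆B r) ξ-over r)
        (from (⇒-⊩ᴺ (renᵖ there (d ξ)) ξ) λ h → gen ξ (to (ren-⊩ᴺ there (d ξ) Along-there) h))

    -- In M this is completeness of `p`, and a valid formula over M stays valid in N.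
    d-¬ᴺ : ∀ (χ : PFormula M (s ∷ Γ)) {f} → ¬ (f ⊩ᴺ d χ) → f ⊩ᴺ d (¬ᵖ χ)
    d-¬ᴺ {Γ = Γ} χ {f} ¬dχ = to (⇒-⊩ᴺ (¬ᵖ d χ) (d (¬ᵖ χ))) (transfer (¬ᵖ d χ ⇒ᵖ d (¬ᵖ χ)) valid f) (λ h → ⊥-elim (¬dχ h))
      where
      valid : ∀ e → e ⊩ (¬ᵖ d χ ⇒ᵖ d (¬ᵖ χ))
      valid e = from (⇒-⊩ (¬ᵖ d χ) (d (¬ᵖ χ))) λ ¬h →
        from (d-⊩ (¬ᵖ χ) {e}) (∉⇒¬∈ p (χ ∙ᵗ e) λ k → ⊥ₚ-elim (¬h (from (d-⊩ χ {e}) k)))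

    Generics : ∀ {k} → Vec (Carrier N s) k → Env N Γ → Set ℓ
    Generics []       f = ⊤
    Generics (x ∷ xs) f = Generic f x × Generics xs (x ∷ f)

    -- One clause of `Generic`, read in the context where `k` later terms have been added.
    generics-formula : ∀ k → PFormula M (s ∷ Γ) → PFormula M (rep s (suc k) Γ)
    generics-formula k χ = renᵖ (weaken k) (renᵖ there (d χ) ⇒ᵖ χ)

    generics-formula-⊩ᴺ : ∀ {k} (χ : PFormula M (s ∷ Γ)) (xs : Vec (Carrier N s) k) (x : Carrier N s) (f : Env N Γ) →
      (xs ⊕ x ∷ f ⊩ᴺ generics-formula k χ) ⇔ (f ⊩ᴺ d χ → x ∷ f ⊩ᴺ χ)
    generics-formula-⊩ᴺ {k = k} χ xs x f = mk⇔
      (λ h dχ → to (⇒-⊩ᴺ (renᵖ there (d χ)) χ) (to r h) (from (ren-⊩ᴺ there (d χ) Along-there) dχ))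
      (λ h → from r (from (⇒-⊩ᴺ (renᵖ there (d χ)) χ) λ dχ → h (to (ren-⊩ᴺ there (d χ) Along-there) dχ)))
      where
      r : (xs ⊕ x ∷ f ⊩ᴺ generics-formula k χ) ⇔ (x ∷ f ⊩ᴺ (renᵖ there (d χ) ⇒ᵖ χ))
      r = ren-⊩ᴺ (weaken k) (renᵖ there (d χ) ⇒ᵖ χ) (lookup-weaken xs (x ∷ f))

    -- Genericity of a sequence is the conjunction of the formulas `generics-formula`, all over M,
    -- and therefore survives compactness arguments.
    generics-elementary : ∀ {k} (xs : Vec (Carrier N s) k) (f : Env N Γ) →
      (∀ (ψ : PFormula M (rep s k Γ)) →
        (∀ (ys : Vec (Carrier N s) k) (g : Env N Γ) → Generics ys g → ys ⊕ g ⊩ᴺ ψ) → xs ⊕ f ⊩ᴺ ψ) →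
      Generics xs f
    generics-elementary []       f h = tt
    generics-elementary {k = suc k} (x ∷ xs) f h =
      (λ χ → to (generics-formula-⊩ᴺ χ xs x f) (h (generics-formula k χ)
        λ { (y ∷ ys) g (gen , _) → from (generics-formula-⊩ᴺ χ ys y g) (gen χ) })) ,
      generics-elementary xs (x ∷ f) λ ψ valid → h ψ λ { (y ∷ ys) g (_ , gens) → valid ys (y ∷ g) gens }

    -- The recursion moves each treated term into `f*`, so `generic-pullback` yields a realization
    -- of `p` over `B` and all earlier terms.
    generics-pullback : Image u ⊆ B → ∀ {k} (xs : Vec (Carrier N s) k) (f : Env N Γ)
      (xs* : Vec (Carrier M s) k) (f* : Env M Γ) →
      (∀ (χ : PFormula M (rep s k Γ)) → Over B χ → xs ⊕ f ⊩ᴺ χ → xs* ⊕ f* ⊩ χ) →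
      Generics xs f → ∀ {C} → C ⊆ B ∪ Range M f* → Mor C xs*
    generics-pullback u⊆B []       f []         f* tr _ C⊆ = tt
    generics-pullback {B = B} u⊆B {suc k} (x ∷ xs) f (x* ∷ xs*) f* tr (gen , gens) {C} C⊆ =
      ⊨↾-antitone {C = C} {C′ = B ∪ Range M f*} C⊆ (generic-pullback {B = B} u⊆B {x} {f} f* gen λ χ o h →
        to (⊩-ren (weaken k) χ (lookup-weaken xs* (x* ∷ f*)))
          (tr (renᵖ (weaken k) χ) (λ r → o r) (from (ren-⊩ᴺ (weaken k) χ (lookup-weaken xs (x ∷ f))) h))) ,
      generics-pullback {B = B} u⊆B xs (x ∷ f) xs* (x* ∷ f*) tr gens {C ∪ ｛ s , x* ｝} extend
      where
      extend : C ∪ ｛ s , x* ｝ ⊆ B ∪ Range M (x* ∷ f*)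
      extend (inj₂ refl) = inj₂ (here refl , refl)
      extend (inj₁ c) with C⊆ c
      ... | inj₁ b        = inj₁ b
      ... | inj₂ (v , eq) = inj₂ (there v , eq)

    NoPatternFor : (q : GlobalType 𝕄 Γ) (θ : PFormula M (s ∷ Γ)) → Set (Level.suc ℓ)
    NoPatternFor q θ = ∃[ n ] NoPattern θ n × (Σ (Vec (Carrier M s) n) λ ms → Mor A ms ×
      (∀ i → (¬ᵖ atᵖ (lookup ms i) θ) ∈ ⟦ q ⟧))

    -- Among n + n′ terms m of `u`, either n have θ(m, ȳ) in `q` or n′ do not. Since n is the bound
    -- for ¬ θ and n′ the one for θ, each case provides a sequence as long as the bound it will
    -- contradict.
    choose-pattern : (q : GlobalType 𝕄 Γ) (θ : PFormula M (s ∷ Γ)) → NoPatternFor q (¬ᵖ θ) ⊎ NoPatternFor q θ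
    choose-pattern q θ =
      [ (λ (ms , ms⊴us , h) → inj₁ (n , proj₂ (no-pattern (¬ᵖ θ)) , ms , ⊴-Mor ms⊴us us-Mor ,
          λ i → entails q (atᵖ (lookup ms i) θ ∷ []) (¬ᵖ ¬ᵖ atᵖ (lookup ms i) θ) (h i ∷ []) λ { e (x ∷ []) ¬x → ¬x x })) ,
        (λ (ms , ms⊴us , h) → inj₂ (n′ , proj₂ (no-pattern θ) , ms , ⊴-Mor ms⊴us us-Mor ,
          λ i → ∉⇒¬∈ q (atᵖ (lookup ms i) θ) (h i))) ]′
      (pigeonhole (em _) (λ m → atᵖ m θ ∈ ⟦ q ⟧) n n′ us refl)
      where
      n n′ : ℕ
      n = proj₁ (no-pattern (¬ᵖ θ))
      n′ = proj₁ (no-pattern θ)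
      us : Vec (Carrier M s) (n + n′)
      us = segment u 0 (n + n′)
      us-Mor : Mor A us
      us-Mor = segment₀-Mor u-Mor (n + n′)

    -- Strong regularity over the whole of M

    module Regular {A′} (A′-small : Small A′) (φ : PFormula M (s ∷ [])) (φ∈p : φ ∈ p ↾ A′)
      (regular : ∀ {B} → Small B → A′ ⊆ B → ∀ a → (a ∷ []) ⊩ φ →
         ((a ∷ []) ⊩* p ↾ B) ⊎ (p ↾ B ⊢ p ↾ (B ∪ Range M (a ∷ [])))) where

      -- Pull (x, f̄, a) back to M over the small set `B₀`. The image of a satisfies `φ` but not
      -- `δ`, so it does not realize `p` over `B₁`, and by regularity `p ↾ B₁` decides `p` over `B₁`
      -- and that image. As the image of x realizes `p ↾ B₁`, it satisfies `χ`, and then so does x.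
      module Insert (f : Env N Γ) (x a : Carrier N s) (δ : PFormula M (s ∷ [])) (δ∈p : δ ∈ ⟦ p ⟧)
        (φa : a ∷ [] ⊩ᴺ φ) (¬δa : ¬ (a ∷ [] ⊩ᴺ δ)) (gen : Generic f x)
        (χ : PFormula M (s ∷ (Γ ++ s ∷ []))) (dχ : ++⁺ f (a ∷ []) ⊩ᴺ d χ) where

        B₀ : ParameterSet M
        B₀ = ((A′ ∪ Image u) ∪ Range M (parameters χ)) ∪ Range M (parameters δ)

        B₀-small : Small B₀
        B₀-small = small-∪ (small-∪ (small-∪ A′-small (Image-countable u))
          (Range-countable x₀ (parameters χ))) (Range-countable x₀ (parameters δ))

        last : Renaming (s ∷ []) (s ∷ (Γ ++ s ∷ []))
        last = there ∘ ∈-++⁺ʳ Γ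

        along-last : ∀ {K : Structure L} (y : Carrier K s) (g : Env K Γ) c → Along last (y ∷ ++⁺ g (c ∷ [])) (c ∷ [])
        along-last y g c = Along-∘ Along-there (lookup-++ʳ g (c ∷ []))

        butlast : Renaming (s ∷ Γ) (s ∷ (Γ ++ s ∷ []))
        butlast = lift-ren s ∈-++⁺ˡ

        along-butlast : ∀ {K : Structure L} (y : Carrier K s) (g : Env K Γ) c → Along butlast (y ∷ ++⁺ g (c ∷ [])) (y ∷ g)
        along-butlast y g c = lookup-lift y (lookup-++ˡ g (c ∷ []))

        module _ (x* : Carrier M s) (f* : Env M Γ) (c : Carrier M s)
          (tr : ∀ ψ → Over B₀ ψ → x ∷ ++⁺ f (a ∷ []) ⊩ᴺ ψ → x* ∷ ++⁺ f* (c ∷ []) ⊩ ψ) where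

          B₁ : ParameterSet M
          B₁ = B₀ ∪ Range M f*

          x*-generic : x* ⊨↾ B₁
          x*-generic = generic-pullback {B = B₀} (λ r → inj₁ (inj₁ (inj₂ r))) {x} {f} f* gen λ ψ o h →
            to (⊩-ren butlast ψ (along-butlast {M} x* f* c))
              (tr (renᵖ butlast ψ) (λ r → o r) (from (ren-⊩ᴺ butlast ψ (along-butlast {N} x f a)) h))

          φc : (c ∷ []) ⊩ φ
          φc = to (⊩-ren last φ (along-last {M} x* f* c))
            (tr (renᵖ last φ) (λ r → inj₁ (inj₁ (inj₁ (proj₂ φ∈p r))))
              (from (ren-⊩ᴺ last φ (along-last {N} x f a)) φa))

          ¬δc : (c ∷ []) ⊩ ¬ᵖ δ
          ¬δc = to (⊩-ren last (¬ᵖ δ) (along-last {M} x* f* c))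
            (tr (renᵖ last (¬ᵖ δ)) (λ r → inj₂ r)
              (from (ren-⊩ᴺ last (¬ᵖ δ) (along-last {N} x f a)) (λ h → ⊥-elim (¬δa h))))

          χ∈p : (χ ∙ᵗ ++⁺ f* (c ∷ [])) ∈ ⟦ p ⟧
          χ∈p = to (d-⊩ χ {++⁺ f* (c ∷ [])}) (to (⊩-ren there (d χ) Along-there)
            (tr (renᵖ there (d χ))
              (λ r → Over-d {B = B₀} χ (λ r → inj₁ (inj₂ r)) (λ r → inj₁ (inj₁ (inj₂ r))) r)
              (from (ren-⊩ᴺ there (d χ) Along-there) dχ)))

          χ-over : Over (B₁ ∪ Range M (c ∷ [])) (χ ∙ᵗ ++⁺ f* (c ∷ []))
          χ-over r = Range-++ {K = M} (B₁ ∪ Range M (c ∷ [])) (++⁺ f* (c ∷ [])) (parameters χ)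
            (Range-++ {K = M} (B₁ ∪ Range M (c ∷ [])) f* (c ∷ []) (λ r → inj₁ (inj₂ r)) inj₂)
            (λ r → inj₁ (inj₁ (inj₁ (inj₂ r)))) r

          χ* : x* ∷ ++⁺ f* (c ∷ []) ⊩ χ
          χ* with regular {B₁} (small-∪ B₀-small (Range-countable x₀ f*)) (λ r → inj₁ (inj₁ (inj₁ (inj₁ r)))) c φc
          -- `B₀` contains the parameters of `δ` precisely to rule out this case.
          ... | inj₁ c⊨p = ⊥ₚ-elim (¬δc (c⊨p {δ} (δ∈p , λ r → inj₁ (inj₂ r))))
          ... | inj₂ ent with ent {χ ∙ᵗ ++⁺ f* (c ∷ [])} (χ∈p , χ-over)
          ... | ψs , ψs∈p , imp = imp (x* ∷ []) (All.map (λ {ψ} h → x*-generic {ψ} h) ψs∈p)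

        χ-holds : x ∷ ++⁺ f (a ∷ []) ⊩ᴺ χ
        χ-holds = by-contradiction λ ¬χ → contradiction (pullback B₀-small (x ∷ ++⁺ f (a ∷ []))) ¬χ
          where
          contradiction : (Σ (Env M (s ∷ (Γ ++ s ∷ []))) λ g* → ∀ ψ → Over B₀ ψ → x ∷ ++⁺ f (a ∷ []) ⊩ᴺ ψ → g* ⊩ ψ) →
            ¬ (x ∷ ++⁺ f (a ∷ []) ⊩ᴺ χ) → ⊥ₚ {ℓ}
          contradiction (x* ∷ g , tr) ¬χ with ++-split Γ g
          ... | f* , c ∷ [] , refl =
                tr (¬ᵖ χ) (λ r → inj₁ (inj₂ r)) (λ h → ⊥-elim (¬χ h)) (χ* x* f* c tr)

      -- An element of φ(N) that does not realize p is independent of the realizations of p.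
      generic-insert : ∀ (f : Env N Γ) {x a} → a ∷ [] ⊩ᴺ φ → ¬ Realizes 𝕄⁺ (a ∷ []) p →
        Generic f x → Generic (++⁺ f (a ∷ [])) x
      generic-insert f {x} {a} φa ¬a⊨p gen χ dχ = by-contradiction λ ¬χ → ⊥-elim (¬a⊨p λ {δ} δ∈p →
        by-contradiction λ ¬δa → ⊥-elim (¬χ (Insert.χ-holds f x a δ δ∈p φa ¬δa gen χ dχ)))

      -- `a` is placed at the far end of the tuple, so that appending it commutes with prepending
      -- the terms of `xs`.
      generics-insert : ∀ {k} (xs : Vec (Carrier N s) k) (f : Env N Γ) {a} →
        a ∷ [] ⊩ᴺ φ → ¬ Realizes 𝕄⁺ (a ∷ []) p → Generics xs f → Generics xs (++⁺ f (a ∷ []))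
      generics-insert []       f φa ¬a⊨p _            = tt
      generics-insert (x ∷ xs) f φa ¬a⊨p (gen , gens) =
        generic-insert f φa ¬a⊨p gen , generics-insert xs (x ∷ f) φa ¬a⊨p gens

      φ-holds : ∀ {x} → Realizes 𝕄⁺ (x ∷ []) p → x ∷ [] ⊩ᴺ φ
      φ-holds x⊨p = x⊨p (proj₁ φ∈p)

      -- Non-orthogonality and p ≤RK q

      module NonOrthogonalCase (q : GlobalType 𝕄 Γ) (θ : PFormula M (s ∷ Γ))
        (¬q≥p : ¬ (p ≤RK[ 𝕄⁺ ] q)) (consistent-θ : ¬ JointlyEntails p q (¬ᵖ θ)) where

        head : Renaming (s ∷ []) (s ∷ Γ)
        head = ∈-++⁺ˡ

        -- b̄ realizes q, and x followed by xs is a Morley sequence in p over M inside θ(N, b̄).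
        record Configuration (k : ℕ) : Set ℓ where
          field
            b       : Env N Γ
            x       : Carrier N s
            xs      : Vec (Carrier N s) k
            b⊨q     : Realizes 𝕄⁺ b q
            x⊨p     : Realizes 𝕄⁺ (x ∷ []) p
            generic : Generics xs (x ∷ [])
            θx      : x ∷ b ⊩ᴺ θ
            θxs     : ∀ i → lookup xs i ∷ b ⊩ᴺ θ

        -- As `p` and `q` do not jointly entail ¬ θ, every `δ` in `p` and `ζ` in `q` are satisfied
        -- in M together with θ.
        configuration₀ : Configuration 0
        configuration₀ = build realized
          where
          E : Pred (PFormula M (s ∷ Γ)) ℓ
          E ψ = ψ ≡ θ
          satisfiable : ∀ δ ζ → δ ∈ ⟦ p ⟧ → ζ ∈ ⟦ q ⟧ → ∃ (Satisfies p q head there E δ ζ)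
          satisfiable δ ζ δ∈p ζ∈q = by-contradiction λ ∄g → ⊥-elim (consistent-θ
            (δ ∷ [] , ζ ∷ [] , δ∈p ∷ [] , ζ∈q ∷ [] , λ { (a ∷ []) b (δa ∷ []) (ζb ∷ []) θab → ⊥-elim (∄g
              (All.map ι (a ∷ b) ,
               from (ren-⊩ᴺ head δ {All.map ι (a ∷ b)} {All.map ι (a ∷ [])} (along λ { (here refl) → refl }))
                 (to (ι-⊩ δ (a ∷ [])) δa) ,
               from (ren-⊩ᴺ there ζ {All.map ι (a ∷ b)} {All.map ι b} Along-there) (to (ι-⊩ ζ b) ζb) ,
               λ { ψ refl → to (ι-⊩ θ (a ∷ b)) θab })) }))
          realized : Σ (Env N (s ∷ Γ)) λ g → (∀ δ → δ ∈ ⟦ p ⟧ → g ⊩ᴺ renᵖ head δ) ×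
            (∀ ζ → ζ ∈ ⟦ q ⟧ → g ⊩ᴺ renᵖ there ζ) × (∀ ψ → ψ ∈ E → g ⊩ᴺ ψ)
          realized = realize-jointly p q head there E satisfiable
          build : (Σ (Env N (s ∷ Γ)) λ g → (∀ δ → δ ∈ ⟦ p ⟧ → g ⊩ᴺ renᵖ head δ) ×
            (∀ ζ → ζ ∈ ⟦ q ⟧ → g ⊩ᴺ renᵖ there ζ) × (∀ ψ → ψ ∈ E → g ⊩ᴺ ψ)) → Configuration 0
          build (x ∷ b , hp , hq , hE) = record
            { b = b ; x = x ; xs = []
            ; b⊨q = λ {ζ} ζ∈q → to (ren-⊩ᴺ there ζ {x ∷ b} {b} Along-there) (hq ζ ζ∈q)
            ; x⊨p = λ {δ} δ∈p → to (ren-⊩ᴺ head δ {x ∷ b} {x ∷ []} (along λ { (here refl) → refl })) (hp δ δ∈p)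
            ; generic = tt ; θx = hE θ refl ; θxs = λ () }

        -- No formula φ(x) ∧ δ(x) ∧ θ(x, b̄) isolates p, so one of them has a solution outside p.
        outside : ∀ {k} (c : Configuration k) δ → δ ∈ ⟦ p ⟧ →
          Σ (Carrier N s) λ a → (a ∷ [] ⊩ᴺ φ) × (a ∷ [] ⊩ᴺ δ) × (a ∷ Configuration.b c ⊩ᴺ θ) × ¬ Realizes 𝕄⁺ (a ∷ []) p
        outside c δ δ∈p = by-contradiction λ ∄a → ⊥-elim (¬q≥p (x ∷ [] , b , x⊨p , b⊨q ,
            semi-isolated⁺ p (x ∷ []) b Ω x⊨p
              (from (Ω-⊩ x) (φ-holds x⊨p , x⊨p δ∈p , θx))
              λ { (a ∷ []) Ωa → by-contradiction {P = Realizes 𝕄⁺ (a ∷ []) p} λ ¬a⊨p →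
                    let φa , δa , θa = to (Ω-⊩ a) Ωa in ⊥-elim (∄a (a , φa , δa , θa , ¬a⊨p)) }))
          where
          open Configuration c
          Ω : PFormula M (s ∷ Γ)
          Ω = renᵖ head φ ∧ᵖ renᵖ head δ ∧ᵖ θ
          Ω-⊩ : ∀ a → (a ∷ b ⊩ᴺ Ω) ⇔ ((a ∷ [] ⊩ᴺ φ) × (a ∷ [] ⊩ᴺ δ) × (a ∷ b ⊩ᴺ θ))
          Ω-⊩ a = mk⇔
            (λ h → let φa , h′ = to (∧-⊩ᴺ (renᵖ head φ) (renᵖ head δ ∧ᵖ θ) {a ∷ b}) h
                       δa , θa = to (∧-⊩ᴺ (renᵖ head δ) θ {a ∷ b}) h′
                   in to (ren-⊩ᴺ head φ al) φa , to (ren-⊩ᴺ head δ al) δa , θa)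
            (λ (φa , δa , θa) → from (∧-⊩ᴺ (renᵖ head φ) (renᵖ head δ ∧ᵖ θ) {a ∷ b})
              (from (ren-⊩ᴺ head φ al) φa ,
               from (∧-⊩ᴺ (renᵖ head δ) θ {a ∷ b}) (from (ren-⊩ᴺ head δ al) δa , θa)))
            where
            al : Along head (a ∷ b) (a ∷ [])
            al = along λ { (here refl) → refl }

        module _ {k} (c : Configuration k) where
          open Configuration c

          X : Context L
          X = rep s (suc k) (s ∷ [])

          -- The place of the new first term; the `suc k` terms of the old sequence come after it.
          oldest : s ∈ˡ X
          oldest = weaken (suc k) (here refl)

          pos : Fin (suc k) → s ∈ˡ X
          pos = position {Γ = s ∷ []}

          ρp : Renaming (s ∷ []) (Γ ++ X)
          ρp (here refl) = ∈-++⁺ʳ Γ oldest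

          along-ρp : ∀ (b : Env N Γ) (a : Carrier N s) (ys : Vec (Carrier N s) (suc k)) →
            Along ρp (++⁺ b (ys ⊕ a ∷ [])) (a ∷ [])
          along-ρp b a ys .at (here refl) =
            trans (lookup-++ʳ b (ys ⊕ a ∷ []) .at oldest) (lookup-weaken {P = Carrier N} ys (a ∷ []) .at (here refl))

          θ-at : ∀ (b : Env N Γ) (e : Env N X) (v : s ∈ˡ X) →
            (++⁺ b e ⊩ᴺ renᵖ (select v) θ) ⇔ (All.lookup e v ∷ b ⊩ᴺ θ)
          θ-at b e v = ren-⊩ᴺ (select v) θ (lookup-select b e v)

          GenericFormula : Pred (PFormula M X) ℓ
          GenericFormula ψ = ∀ (ys : Vec (Carrier N s) (suc k)) g → Generics ys g → ys ⊕ g ⊩ᴺ ψ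

          -- θ at every term, together with all formulas valid on generic sequences; by
          -- `generics-elementary` the latter make the realization generic again.
          E : Pred (PFormula M (Γ ++ X)) ℓ
          E ψ = (Σ (s ∈ˡ X) λ v → ψ ≡ renᵖ (select v) θ × (v ≡ oldest ⊎ ∃[ i ] v ≡ pos i)) ⊎
                (∃[ ψ₀ ] ψ ≡ renᵖ (∈-++⁺ʳ Γ) ψ₀ × GenericFormula ψ₀)

          lookup-oldest : ∀ (a : Carrier N s) (ys : Vec (Carrier N s) (suc k)) →
            All.lookup {P = Carrier N} (ys ⊕ a ∷ []) oldest ≡ a
          lookup-oldest a ys = lookup-weaken {P = Carrier N} ys (a ∷ []) .at (here refl)

          -- The new first term is approximated by a solution a of `δ` outside `p`. Being outside
          -- `p`, it can be put in front: the old sequence stays generic over a. Only in the limit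
          -- over all `δ` does the first term realize `p`.
          satisfiable : ∀ δ ζ → δ ∈ ⟦ p ⟧ → ζ ∈ ⟦ q ⟧ → ∃ (Satisfies p q ρp ∈-++⁺ˡ E δ ζ)
          satisfiable δ ζ δ∈p ζ∈q = g , from (ren-⊩ᴺ ρp δ (along-ρp b a ys)) δa ,
              from (ren-⊩ᴺ ∈-++⁺ˡ ζ (lookup-++ˡ b e)) (b⊨q ζ∈q) , E-holds
            where
            O : Σ (Carrier N s) λ a → (a ∷ [] ⊩ᴺ φ) × (a ∷ [] ⊩ᴺ δ) × (a ∷ b ⊩ᴺ θ) × ¬ Realizes 𝕄⁺ (a ∷ []) p
            O = outside c δ δ∈p
            a : Carrier N s
            a = proj₁ O
            φa : a ∷ [] ⊩ᴺ φ
            φa = proj₁ (proj₂ O)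
            δa : a ∷ [] ⊩ᴺ δ
            δa = proj₁ (proj₂ (proj₂ O))
            θa : a ∷ b ⊩ᴺ θ
            θa = proj₁ (proj₂ (proj₂ (proj₂ O)))
            ¬a⊨p : ¬ Realizes 𝕄⁺ (a ∷ []) p
            ¬a⊨p = proj₂ (proj₂ (proj₂ (proj₂ O)))
            ys : Vec (Carrier N s) (suc k)
            ys = x ∷ xs
            e : Env N X
            e = ys ⊕ a ∷ []
            g : Env N (Γ ++ X)
            g = ++⁺ b e
            ys-generic : Generics ys (a ∷ [])
            ys-generic = generic-insert [] φa ¬a⊨p (generic-[] x⊨p) , generics-insert xs (x ∷ []) φa ¬a⊨p generic
            θys : ∀ i → lookup ys i ∷ b ⊩ᴺ θ
            θys zero    = θx
            θys (suc i) = θxs i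
            E-holds : ∀ ψ → ψ ∈ E → g ⊩ᴺ ψ
            E-holds ψ (inj₁ (v , refl , inj₁ refl)) = from (θ-at b e oldest)
              (subst (λ y → y ∷ b ⊩ᴺ θ) (sym (lookup-oldest a ys)) θa)
            E-holds ψ (inj₁ (v , refl , inj₂ (i , refl))) = from (θ-at b e (pos i))
              (subst (λ y → y ∷ b ⊩ᴺ θ) (sym (lookup-position {P = Carrier N} ys (a ∷ []) i)) (θys i))
            E-holds ψ (inj₂ (ψ₀ , refl , gen)) =
              from (ren-⊩ᴺ (∈-++⁺ʳ Γ) ψ₀ (lookup-++ʳ b e)) (gen ys (a ∷ []) ys-generic)

          Realized : Env N (Γ ++ X) → Set ℓ
          Realized g = (∀ δ → δ ∈ ⟦ p ⟧ → g ⊩ᴺ renᵖ ρp δ) × (∀ ζ → ζ ∈ ⟦ q ⟧ → g ⊩ᴺ renᵖ ∈-++⁺ˡ ζ) ×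
            (∀ ψ → ψ ∈ E → g ⊩ᴺ ψ)

          build : ∀ b a ys → Realized (++⁺ b (ys ⊕ a ∷ [])) → Configuration (suc k)
          build b a ys (hp , hq , hE) = record
            { b = b ; x = a ; xs = ys
            ; b⊨q = λ {ζ} ζ∈q → to (ren-⊩ᴺ ∈-++⁺ˡ ζ (lookup-++ˡ b e)) (hq ζ ζ∈q)
            ; x⊨p = λ {δ} δ∈p → to (ren-⊩ᴺ ρp δ (along-ρp b a ys)) (hp δ δ∈p)
            ; generic = generics-elementary ys (a ∷ []) λ ψ valid →
                to (ren-⊩ᴺ (∈-++⁺ʳ Γ) ψ (lookup-++ʳ b e))
                  (hE (renᵖ (∈-++⁺ʳ Γ) ψ) (inj₂ (ψ , refl , valid)))
            ; θx = subst (λ y → y ∷ b ⊩ᴺ θ) (lookup-oldest a ys)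
                (to (θ-at b e oldest) (hE _ (inj₁ (oldest , refl , inj₁ refl))))
            ; θxs = λ i → subst (λ y → y ∷ b ⊩ᴺ θ) (lookup-position {P = Carrier N} ys (a ∷ []) i)
                (to (θ-at b e (pos i)) (hE _ (inj₁ (pos i , refl , inj₂ (i , refl))))) }
            where
            e : Env N X
            e = ys ⊕ a ∷ []

          extend-configuration : Configuration (suc k)
          extend-configuration = split (realize-jointly p q ρp ∈-++⁺ˡ E satisfiable)
            where
            split : Σ (Env N (Γ ++ X)) Realized → Configuration (suc k)
            split (g , h) with ++-split Γ g
            ... | b , e , refl with ⊕-split {s = s} {Γ = s ∷ []} (suc k) e
            ... | ys , a ∷ [] , refl = build b a ys h

        configuration : ∀ k → Configuration k
        configuration zero    = configuration₀
        configuration (suc k) = extend-configuration (configuration k)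

        module _ (n : ℕ) (np : NoPattern θ n) (ms : Vec (Carrier M s) n) (ms-Mor : Mor A ms)
          (¬θms : ∀ i → (¬ᵖ atᵖ (lookup ms i) θ) ∈ ⟦ q ⟧) where
          open Configuration (configuration n)

          B₁ : ParameterSet M
          B₁ = ((A ∪ Image u) ∪ Range M (ms ⊕ [])) ∪ Range M (parameters θ)

          B₁-small : Small B₁
          B₁-small = small-∪ (small-∪ (small-∪ A-small (Image-countable u))
            (Range-countable x₀ (ms ⊕ []))) (Range-countable x₀ (parameters θ))

          ms∈B₁ : ∀ i → (s , lookup ms i) ∈ B₁
          ms∈B₁ i = inj₁ (inj₂ (position i , lookup-position {P = Carrier M} ms [] i))

          Y : Context L
          Y = rep s n (s ∷ [])

          e₁ : Env N Y
          e₁ = xs ⊕ x ∷ []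

          -- θ(-, b̄*) fails on `ms` because b̄ realizes `q`, and holds on `xs*`, which is Morley
          -- over a set containing `ms`: a pattern of the forbidden length.
          no-pulled : ∀ (b* : Env M Γ) (xs* : Vec (Carrier M s) n) (x* : Carrier M s) →
            (∀ χ → Over B₁ χ → ++⁺ b e₁ ⊩ᴺ χ → ++⁺ b* (xs* ⊕ x* ∷ []) ⊩ χ) → ⊥ₚ {ℓ}
          no-pulled b* xs* x* tr = np ms xs* b* {B₁} (λ r → inj₁ (inj₁ (inj₁ r))) ms∈B₁ ms-Mor xs*-Mor ¬θ* θ*
            where
            e* : Env M Y
            e* = xs* ⊕ x* ∷ []
            xs*-Mor : Mor B₁ xs*
            xs*-Mor = generics-pullback {B = B₁} (λ r → inj₁ (inj₁ (inj₂ r))) xs (x ∷ []) xs* (x* ∷ [])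
              (λ χ o h → to (⊩-ren (∈-++⁺ʳ Γ) χ (lookup-++ʳ b* e*))
                (tr (renᵖ (∈-++⁺ʳ Γ) χ) (λ r → o r) (from (ren-⊩ᴺ (∈-++⁺ʳ Γ) χ (lookup-++ʳ b e₁)) h)))
              generic {B₁} inj₁
            ¬θ* : ∀ i → ¬ (lookup ms i ∷ b* ⊩ θ)
            ¬θ* i h = ⊥ₚ-elim (to (⊩-ren ∈-++⁺ˡ (¬ᵖ θm) (lookup-++ˡ b* e*))
                (tr (renᵖ ∈-++⁺ˡ (¬ᵖ θm)) (λ r → Over-at {K = M} {B = B₁} (lookup ms i) θ (ms∈B₁ i) (λ r → inj₂ r) r)
                  (from (ren-⊩ᴺ ∈-++⁺ˡ (¬ᵖ θm) (lookup-++ˡ b e₁)) (b⊨q (¬θms i))))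
                (from (at-⊩ (lookup ms i) θ) h))
              where
              θm : PFormula M Γ
              θm = atᵖ (lookup ms i) θ
            θ* : ∀ i → lookup xs* i ∷ b* ⊩ θ
            θ* i = subst (λ y → y ∷ b* ⊩ θ) (lookup-position {P = Carrier M} xs* (x* ∷ []) i)
              (to (⊩-ren (select (position i)) θ (lookup-select b* e* (position i)))
                (tr (renᵖ (select (position i)) θ) (λ r → inj₂ r)
                  (from (ren-⊩ᴺ (select (position i)) θ (lookup-select b e₁ (position i)))
                    (subst (λ y → y ∷ b ⊩ᴺ θ) (sym (lookup-position {P = Carrier N} xs (x ∷ []) i)) (θxs i)))))

          impossible : ⊥ₚ {ℓ}
          impossible = split (pullback B₁-small (++⁺ b e₁))
            where
            split : (Σ (Env M (Γ ++ Y)) λ g → ∀ χ → Over B₁ χ → ++⁺ b e₁ ⊩ᴺ χ → g ⊩ χ) → ⊥ₚ {ℓ}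
            split (g , tr) with ++-split Γ g
            ... | b* , e* , refl with ⊕-split {s = s} {Γ = s ∷ []} n e*
            ... | xs* , x* ∷ [] , refl = no-pulled b* xs* x* tr

      nonorthogonal⇒≤RK : (q : GlobalType 𝕄 Γ) → NonOrthogonal p q → p ≤RK[ 𝕄⁺ ] q
      nonorthogonal⇒≤RK q nonorth = by-contradiction λ ¬q≥p → ⊥-elim (nonorth λ θ →
        by-contradiction λ ¬decided → undecided ¬q≥p θ (λ h → ¬decided (inj₁ h)) (λ h → ¬decided (inj₂ h)))
        where
        undecided : ¬ (p ≤RK[ 𝕄⁺ ] q) → ∀ θ → ¬ JointlyEntails p q θ → ¬ JointlyEntails p q (¬ᵖ θ) → ⊥ₚ {ℓ}
        undecided ¬q≥p θ ¬θ ¬¬θ =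
          -- Consistency of ¬ θ with the two types is non-entailment of θ, up to a double negation.
          [ (λ (n , np , ms , ms-Mor , h) → NonOrthogonalCase.impossible q (¬ᵖ θ) ¬q≥p
               (λ (φs , ψs , φs∈p , ψs∈q , ent) → ¬θ (φs , ψs , φs∈p , ψs∈q ,
                 λ a b x y → by-contradiction λ ¬z → ent a b x y (λ z → ⊥-elim (¬z z))))
               n np ms ms-Mor h) ,
            (λ (n , np , ms , ms-Mor , h) → NonOrthogonalCase.impossible q θ ¬q≥p ¬¬θ n np ms ms-Mor h) ]′
          (choose-pattern q θ)

      -- Let θ(-, b̄) imply `p`, with x a solution. If the types entailed θ, some `δ` in `p` would
      -- imply θ(-, b̄) and hence all of `p`, making `p` algebraic; (x, b̄) shows that they do not
      -- entail ¬ θ.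
      ≤RK⇒nonorthogonal : NonAlgebraic p → (q : GlobalType 𝕄 Γ) → p ≤RK[ 𝕄⁺ ] q → NonOrthogonal p q
      ≤RK⇒nonorthogonal {Γ = Γ} nonalg q (x ∷ [] , b , x⊨p , b⊨q , x∈Sem) orth =
        [ (λ h → isolated (jointly-entails-transfer p q θ h)) , (λ h → refuted (jointly-entails-transfer p q (¬ᵖ θ) h)) ]′ (orth θ)
        where
        S : Σ (PFormula M (s ∷ Γ)) λ θ → (x ∷ b ⊩ᴺ θ) × (∀ e → ++⁺ e b ⊩ᴺ θ → Realizes 𝕄⁺ e p)
        S = semi-isolated⁻ p (x ∷ []) b x⊨p x∈Sem
        θ : PFormula M (s ∷ Γ)
        θ = proj₁ S
        isolated : ¬ (∃[ δ ] ∃[ ζ ] δ ∈ ⟦ p ⟧ × ζ ∈ ⟦ q ⟧ × (∀ e b → e ⊩ᴺ δ → b ⊩ᴺ ζ → ++⁺ e b ⊩ᴺ θ))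
        isolated (δ , ζ , δ∈p , ζ∈q , h) with consistent p (δ ∷ []) (δ∈p ∷ [])
        ... | m , δm ∷ [] = isolated⇒algebraic p δ m δm (λ e δe → proj₂ (proj₂ S) e (h e b δe (b⊨q ζ∈q))) nonalg
        refuted : ¬ (∃[ δ ] ∃[ ζ ] δ ∈ ⟦ p ⟧ × ζ ∈ ⟦ q ⟧ × (∀ e b → e ⊩ᴺ δ → b ⊩ᴺ ζ → ++⁺ e b ⊩ᴺ ¬ᵖ θ))
        refuted (δ , ζ , δ∈p , ζ∈q , h) =
          ⊥ₚ-elim (h (x ∷ []) b (x⊨p δ∈p) (b⊨q ζ∈q) (proj₁ (proj₂ S)))

      -- Minimality of p in the Rudin-Keisler order

      module Minimality (q : GlobalType 𝕄 Γ) (nonalg : NonAlgebraic q) (b : Env N Γ) (x : Carrier N s)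
        (b⊨q : Realizes 𝕄⁺ b q) (x⊨p : Realizes 𝕄⁺ (x ∷ []) p) (θ : PFormula M (Γ ++ s ∷ []))
        (θbx : ++⁺ b (x ∷ []) ⊩ᴺ θ) (θ⊢q : ∀ e → ++⁺ e (x ∷ []) ⊩ᴺ θ → Realizes 𝕄⁺ e q) where

        two : Context L
        two = s ∷ s ∷ []

        pick : s ∈ˡ two → Renaming (s ∷ []) (Γ ++ two)
        pick v (here refl) = ∈-++⁺ʳ Γ v

        θ⟨_⟩ : s ∈ˡ two → PFormula M (Γ ++ two)
        θ⟨ v ⟩ = renᵖ (copair ∈-++⁺ˡ (pick v)) θ

        θ⟨⟩-⊩ᴺ : ∀ v (c : Env N Γ) (e : Env N two) → (++⁺ c e ⊩ᴺ θ⟨ v ⟩) ⇔ (++⁺ c (All.lookup e v ∷ []) ⊩ᴺ θ)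
        θ⟨⟩-⊩ᴺ v c e = ren-⊩ᴺ (copair ∈-++⁺ˡ (pick v)) θ
          (lookup-copair {f = ∈-++⁺ˡ} {g = pick v} {e₁ = c} {All.lookup e v ∷ []} (lookup-++ˡ c e)
            (along λ { (here refl) → lookup-++ʳ c e .at v }))

        θ₀ θ₁ : PFormula M (Γ ++ two)
        θ₀ = θ⟨ here refl ⟩
        θ₁ = θ⟨ there (here refl) ⟩

        θ₀-⊩ᴺ : ∀ (c : Env N Γ) y z → (++⁺ c (y ∷ z ∷ []) ⊩ᴺ θ₀) ⇔ (++⁺ c (y ∷ []) ⊩ᴺ θ)
        θ₀-⊩ᴺ c y z = θ⟨⟩-⊩ᴺ (here refl) c (y ∷ z ∷ [])

        θ₁-⊩ᴺ : ∀ (c : Env N Γ) y z → (++⁺ c (y ∷ z ∷ []) ⊩ᴺ θ₁) ⇔ (++⁺ c (z ∷ []) ⊩ᴺ θ)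
        θ₁-⊩ᴺ c y z = θ⟨⟩-⊩ᴺ (there (here refl)) c (y ∷ z ∷ [])

        -- For m in M, `meet` at (x, m) implies `sub` at (x, m): all solutions of θ(ȳ, x) realize
        -- the complete type `q`, so if one of them satisfies θ(ȳ, m), then this formula is in `q`
        -- and all of them do.
        meet sub : PFormula M two
        meet = ∃*ᵖ Γ (θ₀ ∧ᵖ θ₁)
        sub  = ∀*ᵖ Γ (θ₀ ⇒ᵖ θ₁)

        meet-⊩ᴺ : ∀ y z → (y ∷ z ∷ [] ⊩ᴺ meet) ⇔ (Σ (Env N Γ) λ c → (++⁺ c (y ∷ []) ⊩ᴺ θ) × (++⁺ c (z ∷ []) ⊩ᴺ θ))
        meet-⊩ᴺ y z = mk⇔
          (λ h → let c , k = to (∃*-⊩ᴺ Γ (θ₀ ∧ᵖ θ₁)) h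
                     k₀ , k₁ = to (∧-⊩ᴺ θ₀ θ₁ {++⁺ c (y ∷ z ∷ [])}) k
                 in c , to (θ₀-⊩ᴺ c y z) k₀ , to (θ₁-⊩ᴺ c y z) k₁)
          (λ (c , k₀ , k₁) → from (∃*-⊩ᴺ Γ (θ₀ ∧ᵖ θ₁)) (c , from (∧-⊩ᴺ θ₀ θ₁ {++⁺ c (y ∷ z ∷ [])})
            (from (θ₀-⊩ᴺ c y z) k₀ , from (θ₁-⊩ᴺ c y z) k₁)))

        sub-⊩ᴺ : ∀ y z → (y ∷ z ∷ [] ⊩ᴺ sub) ⇔ (∀ (c : Env N Γ) → ++⁺ c (y ∷ []) ⊩ᴺ θ → ++⁺ c (z ∷ []) ⊩ᴺ θ)
        sub-⊩ᴺ y z = mk⇔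
          (λ h c k → to (θ₁-⊩ᴺ c y z) (to (⇒-⊩ᴺ θ₀ θ₁ {++⁺ c (y ∷ z ∷ [])}) (to (∀*-⊩ᴺ Γ (θ₀ ⇒ᵖ θ₁)) h c)
            (from (θ₀-⊩ᴺ c y z) k)))
          (λ h → from (∀*-⊩ᴺ Γ (θ₀ ⇒ᵖ θ₁)) λ c → from (⇒-⊩ᴺ θ₀ θ₁ {++⁺ c (y ∷ z ∷ [])})
            λ k → from (θ₁-⊩ᴺ c y z) (h c (to (θ₀-⊩ᴺ c y z) k)))

        decide : ∀ (χ : PFormula M two) m → (x ∷ ι m ∷ [] ⊩ᴺ χ) → (χ ∙ᵗ (m ∷ [])) ∈ ⟦ p ⟧
        decide χ m h with complete p (χ ∙ᵗ (m ∷ []))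
        ... | inj₁ k = k
        ... | inj₂ k = ⊥ₚ-elim (x⊨p k h)

        θ[_] : Carrier M s → PFormula M Γ
        θ[ m ] = θ ∙ (m ∷ [])

        θ[]-⊩ᴺ : ∀ m (c : Env N Γ) → (c ⊩ᴺ θ[ m ]) ⇔ (++⁺ c (ι m ∷ []) ⊩ᴺ θ)
        θ[]-⊩ᴺ m c = ∙-⊩ᴺ θ (m ∷ [])

        module _ (m : Carrier M s) (meet-m : (meet ∙ᵗ (m ∷ [])) ∈ ⟦ p ⟧) where

          θm∈q : θ[ m ] ∈ ⟦ q ⟧
          θm∈q with to (meet-⊩ᴺ x (ι m)) (x⊨p meet-m) | complete q θ[ m ]
          ... | _            | inj₁ h = h
          ... | c , θcx , θcm | inj₂ h = ⊥ₚ-elim (θ⊢q c θcx h (from (θ[]-⊩ᴺ m c) θcm))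

          sub-m : (sub ∙ᵗ (m ∷ [])) ∈ ⟦ p ⟧
          sub-m = decide sub m (from (sub-⊩ᴺ x (ι m)) λ c θcx → to (θ[]-⊩ᴺ m c) (θ⊢q c θcx θm∈q))

        -- From `d meet` in `p` follows `d sub` in `p`, and by symmetry some m in M satisfies
        -- `d meet` while θ(ȳ, m) implies θ(ȳ, x). Then θ(ȳ, m) is in `q` and implies all of `q`, so
        -- `q` would be algebraic.
        d-meet∉p : ¬ (d meet ∈ ⟦ p ⟧)
        d-meet∉p d-meet∈p = isolates (consistent p (d meet ∷ d (renᵖ swap sub) ∷ []) (d-meet∈p ∷ d-symmetric sub d-sub∈p ∷ []))
          where
          d-sub∈p : d sub ∈ ⟦ p ⟧
          d-sub∈p = entails p (d meet ∷ []) (d sub) (d-meet∈p ∷ []) λ { (m ∷ []) (h ∷ []) →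
            from (d-⊩ sub {m ∷ []}) (sub-m m (to (d-⊩ meet {m ∷ []}) h)) }
          isolates : ¬ (Σ (Env M (s ∷ [])) λ e → All (e ⊩_) (d meet ∷ d (renᵖ swap sub) ∷ []))
          isolates (m ∷ [] , d-meet-m ∷ d-sub-m ∷ []) with consistent q (θ[ m ] ∷ []) (θm∈q m (to (d-⊩ meet {m ∷ []}) d-meet-m) ∷ [])
          ... | e , θme ∷ [] = isolated⇒algebraic q θ[ m ] e θme (λ g h → θ⊢q g (superset g (to (θ[]-⊩ᴺ m g) h))) nonalg
            where
            superset : ∀ (c : Env N Γ) → ++⁺ c (ι m ∷ []) ⊩ᴺ θ → ++⁺ c (x ∷ []) ⊩ᴺ θ
            superset = to (sub-⊩ᴺ (ι m) x) (to (ren-⊩ᴺ swap sub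
              (along λ { (here refl) → refl ; (there (here refl)) → refl }))
              (x⊨p (to (d-⊩ (renᵖ swap sub) {m ∷ []}) d-sub-m)))

        head′ : Renaming (s ∷ []) (s ∷ Γ)
        head′ = ∈-++⁺ˡ

        -- θ has the variable of `p` last, whereas a formula isolating `p` over b̄ must have it
        -- first.
        θ-renaming : Renaming (Γ ++ s ∷ []) (s ∷ Γ)
        θ-renaming = copair {Γ = Γ} there head′

        Ω : PFormula M (s ∷ Γ)
        Ω = renᵖ head′ φ ∧ᵖ renᵖ head′ (¬ᵖ d meet) ∧ᵖ renᵖ θ-renaming θ

        Ω-⊩ᴺ : ∀ a → (a ∷ b ⊩ᴺ Ω) ⇔ ((a ∷ [] ⊩ᴺ φ) × (a ∷ [] ⊩ᴺ ¬ᵖ d meet) × (++⁺ b (a ∷ []) ⊩ᴺ θ))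
        Ω-⊩ᴺ a = mk⇔
          (λ h → let h₁ , h′ = to (∧-⊩ᴺ (renᵖ head′ φ) (renᵖ head′ (¬ᵖ d meet) ∧ᵖ renᵖ θ-renaming θ) {a ∷ b}) h
                     h₂ , h₃ = to (∧-⊩ᴺ (renᵖ head′ (¬ᵖ d meet)) (renᵖ θ-renaming θ) {a ∷ b}) h′
                 in to (ren-⊩ᴺ head′ φ al) h₁ , to (ren-⊩ᴺ head′ (¬ᵖ d meet) al) h₂ , to (ren-⊩ᴺ θ-renaming θ al′) h₃)
          (λ (h₁ , h₂ , h₃) → from (∧-⊩ᴺ (renᵖ head′ φ) (renᵖ head′ (¬ᵖ d meet) ∧ᵖ renᵖ θ-renaming θ) {a ∷ b}) (from (ren-⊩ᴺ head′ φ al) h₁ ,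
            from (∧-⊩ᴺ (renᵖ head′ (¬ᵖ d meet)) (renᵖ θ-renaming θ) {a ∷ b})
              (from (ren-⊩ᴺ head′ (¬ᵖ d meet) al) h₂ , from (ren-⊩ᴺ θ-renaming θ al′) h₃)))
          where
          al : Along head′ (a ∷ b) (a ∷ [])
          al = along λ { (here refl) → refl }
          al′ : Along θ-renaming (a ∷ b) (++⁺ b (a ∷ []))
          al′ = lookup-copair {e₁ = b} {a ∷ []} Along-there al

        -- If a ∈ φ(N) does not realize p, then x is generic over a, while b̄ witnesses meet(x, a).
        Ω⊢p : ∀ a → a ∷ b ⊩ᴺ Ω → ¬ ¬ Realizes 𝕄⁺ (a ∷ []) p
        Ω⊢p a Ωa ¬a⊨p = ⊥ₚ-elim (¬meet (from (meet-⊩ᴺ x a) (b , θbx , proj₂ (proj₂ h))))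
          where
          h : (a ∷ [] ⊩ᴺ φ) × (a ∷ [] ⊩ᴺ ¬ᵖ d meet) × (++⁺ b (a ∷ []) ⊩ᴺ θ)
          h = to (Ω-⊩ᴺ a) Ωa
          ¬meet : x ∷ a ∷ [] ⊩ᴺ ¬ᵖ meet
          ¬meet = generic-insert [] (proj₁ h) ¬a⊨p (generic-[] x⊨p) (¬ᵖ meet)
            (d-¬ᴺ meet λ k → ⊥ₚ-elim (proj₁ (proj₂ h) k))

        p≤q : p ≤RK[ 𝕄⁺ ] q
        p≤q = x ∷ [] , b , x⊨p , b⊨q , semi-isolated⁺ p (x ∷ []) b Ω x⊨p
          (from (Ω-⊩ᴺ x) (φ-holds x⊨p , x⊨p (∉⇒¬∈ p (d meet) d-meet∉p) , θbx))
          λ { (a ∷ []) Ωa → by-contradiction {P = Realizes 𝕄⁺ (a ∷ []) p} λ ¬a⊨p → ⊥-elim (Ω⊢p a Ωa ¬a⊨p) }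

      minimal : (q : GlobalType 𝕄 Γ) → NonAlgebraic q → q ≤RK[ 𝕄⁺ ] p → p ≤RK[ 𝕄⁺ ] q
      minimal q nonalg (b , x ∷ [] , b⊨q , x⊨p , b∈Sem) =
        let θ , θbx , θ⊢q = semi-isolated⁻ q b (x ∷ []) b⊨q b∈Sem
        in Minimality.p≤q q nonalg b x b⊨q x⊨p θ θbx θ⊢q

theorem2 : ∀ {ℓ} → (∀ ℓ′ → ExcludedMiddle ℓ′) →
    {L : Language ℓ} (T : Theory L) → Complete T →
    (𝕄 : MonsterModel T) (𝕄⁺ : LargerMonster 𝕄) →
    ∀ {s} (p : GlobalType 𝕄 (s ∷ [])) →
    GenericallyStable p → StronglyRegular p →
    (∀ {Γ} (q : GlobalType 𝕄 Γ) → NonAlgebraic q →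
    q ≤RK[ 𝕄⁺ ] p → p ≤RK[ 𝕄⁺ ] q) ×
    (∀ {Γ} (q : GlobalType 𝕄 Γ) → Invariant q →
    NonOrthogonal p q ⇔ p ≤RK[ 𝕄⁺ ] q)
theorem2 em T _ 𝕄 𝕄⁺ p (nonalg , A , A-small , A-inv , stable) (φ , _ , A′ , A′-small , _ , φ∈p , regular) =
  minimal , λ q _ → mk⇔ (nonorthogonal⇒≤RK q) (≤RK⇒nonorthogonal nonalg q)
  where
  open Stable em 𝕄 𝕄⁺ p
  -- `A` and `A′` need not agree: regularity is only applied over sets that contain both `A′` and
  -- the terms of `u`.
  open Stability A-small A-inv stable
  open Regular A′-small φ φ∈p regular
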